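{- Let $k\geq 4$ and $n>k$ be integers. If $G$ is a $2$-connected graph on $n$ vertices with chromatic number $\chi(G)=k$ and independence number $\alpha(G)=2$, then for every integer $x\geq k$, $$P(G,x)\leq(x-1)_{k-1}\big((x-1)^{n-k+1}+(-1)^{n-k}\big),$$ with equality if and only if $G\cong G_{k+1,k}$ or $G\cong G_{k+2,k}$.
   Context: All graphs are finite and simple. $P(G,x)$ denotes the chromatic polynomial of $G$, i.e., for a positive integer $x$ the number of proper colorings $c:V(G)\to\{1,\dots,x\}$. $(x)_m=x(x-1)\cdots(x-m+1)$ denotes the falling factorial. $\alpha(G)$ is the independence number. For $m\ge k$, $G_{m,k}$ is the graph on $m$ vertices obtained from a $k$-clique by adding a path with $m-k$ new internal vertices (each of degree $2$) whose endpoints are two distinct vertices of the clique. -}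

module Defs where

open import Data.Nat.Base using (ℕ; zero; suc; _+_; _*_; _∸_; _^_; _≤_; _<_; _≡ᵇ_; _<ᵇ_; _≤ᵇ_)
open import Data.Integer.Base as ℤ using (ℤ; +_; -1ℤ)
open import Data.Bool.Base using (Bool; true; false; _∧_; _∨_; not)
open import Data.Bool.Properties using (∨-comm)
open import Data.Fin.Base using (Fin; toℕ)
open import Data.Fin.Properties using (all?; _≟_)
open import Data.List.Base using (List; []; _∷_; length; filter; concatMap; map; allFin)
open import Data.Product.Base using (Σ; ∃; _×_; _,_)
open import Data.Unit.Base using (⊤)
open import Relation.Nullary using (¬_; Dec; yes; no)
open import Relation.Nullary.Decidable using (¬?; _→-dec_)
open import Relation.Binary.PropositionalEquality using (_≡_; _≢_; refl; cong₂)
open import Function.Bundles using (_↔_; Inverse)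
import Data.Fin.Base as Fin
import Data.Bool.Properties as BoolP

record Graph (n : ℕ) : Set where
  field
    adj    : Fin n → Fin n → Bool
    sym    : ∀ i j → adj i j ≡ adj j i
    irrefl : ∀ i → adj i i ≡ false
open Graph public

Adj : ∀ {n} → Graph n → Fin n → Fin n → Set
Adj G i j = adj G i j ≡ true

IsProper : ∀ {n x} → Graph n → (Fin n → Fin x) → Set
IsProper {n} G c = ∀ (i j : Fin n) → Adj G i j → c i ≢ c j

isProper? : ∀ {n x} (G : Graph n) (c : Fin n → Fin x) → Dec (IsProper G c)
isProper? G c =
  all? (λ i → all? (λ j → (adj G i j Data.Bool.Properties.≟ true) →-dec ¬? (c i ≟ c j)))

allFuns : ∀ n x → List (Fin n → Fin x)
allFuns zero    x = (λ ()) ∷ []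
allFuns (suc n) x =
  concatMap (λ a → map (λ f → fcons a f) (allFuns n x)) (allFin x)
  where
    fcons : Fin x → (Fin n → Fin x) → Fin (suc n) → Fin x
    fcons a f Fin.zero    = a
    fcons a f (Fin.suc i) = f i

P : ∀ {n} → Graph n → ℕ → ℕ
P {n} G x = length (filter (isProper? G) (allFuns n x))

ChromaticNumber : ∀ {n} → Graph n → ℕ → Set
ChromaticNumber {n} G k =
  (Σ (Fin n → Fin k) (IsProper G)) ×
  (¬ Σ (Fin n → Fin (k ∸ 1)) (IsProper G))

IndepSet : ∀ {n} → Graph n → ℕ → Set
IndepSet {n} G m =
  Σ (Fin m → Fin n) λ f →
    (∀ i j → f i ≡ f j → i ≡ j) ×
    (∀ i j → ¬ Adj G (f i) (f j))

IndependenceNumber : ∀ {n} → Graph n → ℕ → Set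
IndependenceNumber G a = IndepSet G a × ¬ IndepSet G (suc a)

data Walk {n} (G : Graph n) (S : Fin n → Set) : Fin n → Fin n → Set where
  here : ∀ {u} → S u → Walk G S u u
  step : ∀ {u v w} → S u → Adj G u v → Walk G S v w → Walk G S u w

ConnectedOn : ∀ {n} → Graph n → (Fin n → Set) → Set
ConnectedOn {n} G S = ∀ (u v : Fin n) → S u → S v → Walk G S u v

TwoConnected : ∀ {n} → Graph n → Set
TwoConnected {n} G =
  (3 ≤ n) × ConnectedOn G (λ _ → ⊤) × (∀ (w : Fin n) → ConnectedOn G (λ v → v ≢ w))

_≅_ : ∀ {n m} → Graph n → Graph m → Set
_≅_ {n} {m} G H =
  Σ (Fin n ↔ Fin m) λ φ → ∀ i j → adj G i j ≡ adj H (Inverse.to φ i) (Inverse.to φ j)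

-- The graphs G_{m,k}
-- vertices 0..k-1 form a clique; the path is 0 - k - (k+1) - ... - (m-1) - 1
-- (if m = k there are no path vertices and G_{k,k} = K_k).  Intended for k ≥ 2.

private
  ≡ᵇ-sym : ∀ a b → (a ≡ᵇ b) ≡ (b ≡ᵇ a)
  ≡ᵇ-sym zero zero = refl
  ≡ᵇ-sym zero (suc b) = refl
  ≡ᵇ-sym (suc a) zero = refl
  ≡ᵇ-sym (suc a) (suc b) = ≡ᵇ-sym a b

  ≡ᵇ-refl : ∀ a → (a ≡ᵇ a) ≡ true
  ≡ᵇ-refl zero = refl
  ≡ᵇ-refl (suc a) = ≡ᵇ-refl a

gcore : ℕ → ℕ → ℕ → ℕ → Bool
gcore m k a b =
  ((a <ᵇ k) ∧ (b <ᵇ k))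
  ∨ ((a ≡ᵇ 0) ∧ (b ≡ᵇ k) ∧ (k <ᵇ m))
  ∨ ((k ≤ᵇ a) ∧ (b ≡ᵇ suc a) ∧ (b <ᵇ m))
  ∨ ((a ≡ᵇ m ∸ 1) ∧ (k ≤ᵇ a) ∧ (b ≡ᵇ 1))

gadj : ℕ → ℕ → ℕ → ℕ → Bool
gadj m k a b = not (a ≡ᵇ b) ∧ (gcore m k a b ∨ gcore m k b a)

G[_,_] : (m k : ℕ) → Graph m
G[ m , k ] = record
  { adj    = λ i j → gadj m k (toℕ i) (toℕ j)
  ; sym    = λ i j → cong₂ (λ x y → not x ∧ y) (≡ᵇ-sym (toℕ i) (toℕ j))
                        (∨-comm (gcore m k (toℕ i) (toℕ j)) (gcore m k (toℕ j) (toℕ i)))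
  ; irrefl = λ i → irr (toℕ i)
  }
  where
    irr : ∀ a → gadj m k a a ≡ false
    irr a rewrite ≡ᵇ-refl a = refl

fall : ℕ → ℕ → ℕ
fall a zero    = 1
fall a (suc j) = a * fall (a ∸ 1) j

bound : ℕ → ℕ → ℕ → ℤ
bound k n x = (+ fall (x ∸ 1) (k ∸ 1)) ℤ.* ((+ ((x ∸ 1) ^ (n ∸ k + 1))) ℤ.+ (-1ℤ ℤ.^ (n ∸ k)))

{-# OPTIONS --safe #-}
module Submission where

-- Let h be the adjacency of the complement of G.  As α(G) = 2, h is triangle-free and every colour
-- class is a single vertex or a pair related by h, so P(G,x) is a weighted count N of matchings of h,
-- and χ(G) = k says that a maximum matching has d = n − k pairs.  Deleting a vertex v gives
--   N(L,x) = x (N(L − v, x − 1) + Σ_{u ~ v} N(L − v − u, x − 1)).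
-- Triangle-freeness yields a vertex of h-degree at most d, and induction along this recursion gives
-- P(G,x) ≤ (x)ₖ (x)_d, which is below the bound when d ≥ 4.  For d = 3 the recursion gains a factor
-- (x − 1)/x, unless h contains a spanning complete bipartite graph, i.e. G is disconnected.
-- For d ≤ 2 the graph h is a star, a union of two stars, or has maximum degree at most 2, and P(G,x) can
-- be computed or estimated directly; minimum degree 2 in G bounds the degrees of the star centres.

open import Defs hiding (sym)
open import Data.Bool.Base using (Bool; true; false; _∧_; _∨_; not)
import Data.Bool.Properties as Bool
open import Data.Empty using (⊥; ⊥-elim)
open import Data.Fin.Base using (Fin; zero; suc; toℕ; _↑ˡ_; _↑ʳ_; splitAt; fromℕ<)
open import Data.Fin.Permutation using (↔⇒≡)
import Data.Fin.Properties as Fin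
open import Data.Fin.Properties using (all?; any?; pigeonhole; ↑ˡ-injective; ↑ʳ-injective; splitAt-↑ˡ; splitAt-↑ʳ; toℕ-fromℕ<; toℕ-↑ˡ; toℕ-↑ʳ)
import Data.Integer.Properties as ℤ
open import Data.List.Base using (List; []; _∷_; length; map; _++_; allFin; filter; tabulate; concatMap)
open import Data.List.Membership.Propositional using (_∈_)
open import Data.List.Membership.Propositional.Properties using (∈-++⁺ˡ; ∈-++⁺ʳ; ∈-++⁻; ∈-allFin; ∈-map⁺; ∈-map⁻; ∈-tabulate⁻)
open import Data.List.Properties using (filter-++; length-++; length-map; length-tabulate)
import Data.List.Relation.Binary.Permutation.Propositional as Perm
open import Data.List.Relation.Binary.Permutation.Propositional using (_↭_; ↭-sym; ↭-trans; ↭-refl; prep; swap)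
open import Data.List.Relation.Binary.Permutation.Propositional.Properties using (↭-length; ∈-resp-↭; All-resp-↭; shift; shifts; ++⁺ˡ; ++-comm; map⁺)
open import Data.List.Relation.Unary.All as All using (All; []; _∷_)
open import Data.List.Relation.Unary.AllPairs using (AllPairs; []; _∷_)
open import Data.List.Relation.Unary.Any using (here; there)
open import Data.List.Relation.Unary.Unique.Propositional using (Unique)
open import Data.List.Relation.Unary.Unique.Propositional.Properties using (allFin⁺)
import Data.List.Relation.Unary.Unique.Propositional.Properties as Unique
open import Data.Nat.Base
open import Data.Nat.Properties
open import Data.Nat.Tactic.RingSolver using (solve-∀)
open import Data.Product.Base using (Σ; ∃; ∃₂; _×_; _,_; proj₁; proj₂)
open import Data.Sum.Base using (_⊎_; inj₁; inj₂)
open import Data.Unit.Base using (⊤; tt)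
open import Function.Base using (_∘_; case_of_)
open import Function.Bundles using (Inverse; mk↔ₛ′; _⇔_; mk⇔)
open import Relation.Binary.PropositionalEquality hiding ([_])
open import Relation.Nullary using (¬_; Dec; yes; no)
open import Relation.Nullary.Decidable using (decidable-stable; ¬¬-excluded-middle; does; dec-true; dec-false; _×-dec_; _→-dec_; ¬?)
open import Relation.Unary using (Decidable)

-- Since `(x)ₖ = x (x − 1)ₖ₋₁`, comparing `(x)ₖ (x)_d` with the claimed bound means comparing
-- `x (x)_d` with `(x − 1)^(d+1) + (−1)^d`. The estimate `(x)ₖ (x)_d` is sharp for two disjoint
-- cliques, a disconnected graph, so it can only suffice when there is room between the two
-- polynomials. For `d ≥ 4` there is: already at `d = 4` the difference `(x − 1)⁵ − x (x)₄` is
-- `(x − 1)(x³ − 4x + 1)`. For `d = 3` the inequality fails, but trading a single factor `x` for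
-- `x − 1` gives `x (x − 1)² (x − 2) = (x − 1)⁴ − (x − 1)²`, which is small enough. Hence
-- connectedness has to be used for `d = 3`, only to gain that one factor, and equality can occur
-- only for `d = 1` and `d = 2`, where the count must be known exactly near its maximum. Vertex sets
-- are lists up to permutation, so that deleting a vertex or a pair never changes the type of
-- vertices.

+-rotate : ∀ a b c → a + (b + c) ≡ b + (a + c)
+-rotate = solve-∀

-- Sums over the removal of one entry from a list.

⟦_⟧ : Bool → ℕ
⟦ true ⟧  = 1
⟦ false ⟧ = 0

-- The sum of F u L′ over all ways of splitting L into an entry u and the remaining list L′.
sumP : {V : Set} → (V → List V → ℕ) → List V → ℕ
sumP F []      = 0
sumP F (u ∷ L) = F u L + sumP (λ w L′ → F w (u ∷ L′)) L

module _ {V : Set} where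

  bring-front : ∀ {u w : V} {L L′} → L ↭ w ∷ L′ → u ∷ L ↭ w ∷ u ∷ L′
  bring-front {u} {w} p = ↭-trans (prep u p) (swap u w ↭-refl)

  sumP-cong : ∀ {F F′ : V → List V → ℕ} L →
    (∀ u L′ → L ↭ u ∷ L′ → F u L′ ≡ F′ u L′) → sumP F L ≡ sumP F′ L
  sumP-cong []      e = refl
  sumP-cong (u ∷ L) e =
    cong₂ _+_ (e u L ↭-refl) (sumP-cong L (λ w L′ p → e w (u ∷ L′) (bring-front p)))

  sumP-+ : ∀ (F F′ : V → List V → ℕ) L →
    sumP (λ u L′ → F u L′ + F′ u L′) L ≡ sumP F L + sumP F′ L
  sumP-+ F F′ []      = refl
  sumP-+ F F′ (u ∷ L) = trans
    (cong (F u L + F′ u L +_) (sumP-+ (λ w L′ → F w (u ∷ L′)) (λ w L′ → F′ w (u ∷ L′)) L))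
    (+-shuffle (F u L) (F′ u L) _ _)
    where
    +-shuffle : ∀ a b c d → a + b + (c + d) ≡ a + c + (b + d)
    +-shuffle = solve-∀

  sumP-* : ∀ c (F : V → List V → ℕ) L → sumP (λ u L′ → c * F u L′) L ≡ c * sumP F L
  sumP-* c F []      = sym (*-zeroʳ c)
  sumP-* c F (u ∷ L) = trans (cong (c * F u L +_) (sumP-* c _ L)) (sym (*-distribˡ-+ c (F u L) _))

  -- Both sides run over ordered pairs of distinct positions together with what remains; only the
  -- order of removal is exchanged. This is the source of the symmetry of `N` in its first two
  -- entries.
  sumP-swap : ∀ (F : V → V → List V → ℕ) L →
    sumP (λ u L′ → sumP (F u) L′) L ≡ sumP (λ u L′ → sumP (λ w → F w u) L′) L
  sumP-swap F []      = refl
  sumP-swap F (v ∷ L) = begin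
    sumP (F v) L + sumP (λ u L′ → F u v L′ + sumP (λ w L″ → F u w (v ∷ L″)) L′) L
      ≡⟨ cong (sumP (F v) L +_) (sumP-+ (λ u → F u v) _ L) ⟩
    sumP (F v) L + (sumP (λ u → F u v) L + sumP (λ u L′ → sumP (λ w L″ → F u w (v ∷ L″)) L′) L)
      ≡⟨ +-rotate (sumP (F v) L) (sumP (λ u → F u v) L) _ ⟩
    sumP (λ u → F u v) L + (sumP (F v) L + sumP (λ u L′ → sumP (λ w L″ → F u w (v ∷ L″)) L′) L)
      ≡⟨ cong (λ s → sumP (λ u → F u v) L + (sumP (F v) L + s)) (sumP-swap (λ u w L″ → F u w (v ∷ L″)) L) ⟩
    sumP (λ u → F u v) L + (sumP (F v) L + sumP (λ u L′ → sumP (λ w L″ → F w u (v ∷ L″)) L′) L)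
      ≡⟨ cong (sumP (λ u → F u v) L +_) (sumP-+ (F v) _ L) ⟨
    sumP (λ u → F u v) L + sumP (λ u L′ → F v u L′ + sumP (λ w L″ → F w u (v ∷ L″)) L′) L ∎
    where
    open ≡-Reasoning

  -- Invariance of `F` is demanded only for lists shorter than `m`, so that `N-↭` can supply it from
  -- an induction hypothesis on the length.
  sumP-↭ : ∀ m {F : V → List V → ℕ} {L L′} →
    (∀ u {M M′} → length M < m → M ↭ M′ → F u M ≡ F u M′) →
    length L ≤ m → L ↭ L′ → sumP F L ≡ sumP F L′
  sumP-↭ m r l Perm.refl = refl
  sumP-↭ (suc m) r (s≤s l) (prep u p) =
    cong₂ _+_ (r u (s≤s l) p) (sumP-↭ m (λ w l′ q → r w (s≤s l′) (prep u q)) l p)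
  sumP-↭ (suc (suc m)) {F} r (s≤s (s≤s l)) (swap {xs = L} {ys = L′} u v p) = begin
    F u (v ∷ L) + (F v (u ∷ L) + sumP (λ w M → F w (u ∷ v ∷ M)) L)
      ≡⟨ +-rotate (F u (v ∷ L)) (F v (u ∷ L)) _ ⟩
    F v (u ∷ L) + (F u (v ∷ L) + sumP (λ w M → F w (u ∷ v ∷ M)) L)
      ≡⟨ cong₂ _+_ (r v (s≤s (s≤s l)) (prep u p)) (cong₂ _+_ (r u (s≤s (s≤s l)) (prep v p))
          (trans (sumP-↭ m (λ w l′ q → r w (s≤s (s≤s l′)) (prep u (prep v q))) l p)
                 (sumP-cong L′ (λ w M q → r w (s≤s (short q)) (swap u v ↭-refl))))) ⟩
    F v (u ∷ L′) + (F u (v ∷ L′) + sumP (λ w M → F w (v ∷ u ∷ M)) L′) ∎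
    where
    open ≡-Reasoning
    short : ∀ {w M} → L′ ↭ w ∷ M → suc (suc (length M)) ≤ suc m
    short q = s≤s (subst (_≤ m) (trans (↭-length p) (↭-length q)) l)
  sumP-↭ m r l (Perm.trans p q) =
    trans (sumP-↭ m r l p) (sumP-↭ m r (subst (_≤ m) (↭-length p) l) q)

-- The weighted count of partitions into singletons and pairs.

module Count {V : Set} (h : V → V → Bool) where

  deg : V → List V → ℕ
  deg v []      = 0
  deg v (u ∷ L) = ⟦ h v u ⟧ + deg v L

  -- The lists `L′` produced by `sumP` are not structurally smaller, so a length bound serves as
  -- fuel. The factor `x` is the number of colours for the block of the first entry; for `x = 0` it
  -- also hides the truncation in `x ∸ 1`.
  countF : ℕ → List V → ℕ → ℕ
  countF zero    L       x = 1
  countF (suc f) []      x = 1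
  countF (suc f) (v ∷ L) x =
    x * (countF f L (x ∸ 1) + sumP (λ u L′ → ⟦ h v u ⟧ * countF f L′ (x ∸ 1)) L)

  -- The sum of (x)ₘ over all partitions of L into singletons and pairs related by h,
  -- m being the number of blocks.
  N : List V → ℕ → ℕ
  N L = countF (length L) L

  countF-fuel : ∀ f g L x → length L ≤ f → length L ≤ g → countF f L x ≡ countF g L x
  countF-fuel zero    zero    L       x p q = refl
  countF-fuel zero    (suc g) []      x p q = refl
  countF-fuel (suc f) zero    []      x p q = refl
  countF-fuel (suc f) (suc g) []      x p q = refl
  countF-fuel (suc f) (suc g) (v ∷ L) x (s≤s p) (s≤s q) = cong (x *_) (cong₂ _+_
    (countF-fuel f g L _ p q)
    (sumP-cong L λ u L′ r → cong (⟦ h v u ⟧ *_)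
      (countF-fuel f g L′ _ (≤-trans (<⇒≤ (≤-reflexive (sym (↭-length r)))) p)
                            (≤-trans (<⇒≤ (≤-reflexive (sym (↭-length r)))) q))))

  N-cons : ∀ v L x →
    N (v ∷ L) x ≡ x * (N L (x ∸ 1) + sumP (λ u L′ → ⟦ h v u ⟧ * N L′ (x ∸ 1)) L)
  N-cons v L x = cong (λ s → x * (N L (x ∸ 1) + s))
    (sumP-cong L λ u L′ r → cong (⟦ h v u ⟧ *_)
      (countF-fuel (length L) (length L′) L′ _ (<⇒≤ (≤-reflexive (sym (↭-length r)))) ≤-refl))

  -- Expanding twice sorts the partitions by the fate of `v` and `w`: both alone (`A`), exactly one
  -- paired with an outside entry (`S v`, `S w`), paired with each other (`B`), paired with two
  -- different outside entries (`D`). The term of `B` is symmetric because `h` is, that of `D` by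
  -- `sumP-swap`.
  N-swap : (∀ u v → h u v ≡ h v u) → ∀ v w L x → N (v ∷ w ∷ L) x ≡ N (w ∷ v ∷ L) x
  N-swap hs v w L x = begin
    N (v ∷ w ∷ L) x
      ≡⟨ expand v w ⟩
    x * ((x ∸ 1) * (A + S w) + (⟦ h v w ⟧ * B + (x ∸ 1) * (S v + D v w)))
      ≡⟨ cong₂ (λ s t → x * ((x ∸ 1) * (A + S w) + (⟦ s ⟧ * B + (x ∸ 1) * (S v + t)))) (hs v w) (D-sym v w) ⟩
    x * ((x ∸ 1) * (A + S w) + (⟦ h w v ⟧ * B + (x ∸ 1) * (S v + D w v)))
      ≡⟨ shuffle x (x ∸ 1) A (S w) (⟦ h w v ⟧ * B) (S v) (D w v) ⟩
    x * ((x ∸ 1) * (A + S v) + (⟦ h w v ⟧ * B + (x ∸ 1) * (S w + D w v)))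
      ≡⟨ expand w v ⟨
    N (w ∷ v ∷ L) x ∎
    where
    open ≡-Reasoning
    A = N L (x ∸ 1 ∸ 1)
    B = N L (x ∸ 1)
    S : V → ℕ
    S v = sumP (λ u L′ → ⟦ h v u ⟧ * N L′ (x ∸ 1 ∸ 1)) L
    D : V → V → ℕ
    D v w = sumP (λ u L′ → sumP (λ u′ L″ → ⟦ h v u ⟧ * (⟦ h w u′ ⟧ * N L″ (x ∸ 1 ∸ 1))) L′) L
    shuffle : ∀ x y a s b t d → x * (y * (a + s) + (b + y * (t + d))) ≡ x * (y * (a + t) + (b + y * (s + d)))
    shuffle = solve-∀
    *-rotate : ∀ a b c → a * (b * c) ≡ b * (a * c)
    *-rotate = solve-∀
    D-sym : ∀ v w → D v w ≡ D w v
    D-sym v w = trans (sumP-swap (λ u u′ L″ → ⟦ h v u ⟧ * (⟦ h w u′ ⟧ * N L″ (x ∸ 1 ∸ 1))) L)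
      (sumP-cong L λ u L′ _ → sumP-cong L′ λ u′ L″ _ → *-rotate ⟦ h v u′ ⟧ ⟦ h w u ⟧ _)
    distr : ∀ a y b s → a * (y * (b + s)) ≡ y * (a * b + a * s)
    distr = solve-∀
    expand : ∀ v w → N (v ∷ w ∷ L) x ≡ x * ((x ∸ 1) * (A + S w) + (⟦ h v w ⟧ * B + (x ∸ 1) * (S v + D v w)))
    expand v w = trans (N-cons v (w ∷ L) x) (cong (x *_) (cong₂ _+_ (N-cons w L (x ∸ 1))
      (cong (⟦ h v w ⟧ * B +_) (begin
        sumP (λ u L′ → ⟦ h v u ⟧ * N (w ∷ L′) (x ∸ 1)) L
          ≡⟨ sumP-cong L (λ u L′ _ → trans (cong (⟦ h v u ⟧ *_) (N-cons w L′ (x ∸ 1)))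
               (trans (distr ⟦ h v u ⟧ (x ∸ 1) (N L′ (x ∸ 1 ∸ 1)) _)
                      (cong (λ s → (x ∸ 1) * (⟦ h v u ⟧ * N L′ (x ∸ 1 ∸ 1) + s)) (sym (sumP-* ⟦ h v u ⟧ _ L′))))) ⟩
        sumP (λ u L′ → (x ∸ 1) * (⟦ h v u ⟧ * N L′ (x ∸ 1 ∸ 1)
                + sumP (λ u′ L″ → ⟦ h v u ⟧ * (⟦ h w u′ ⟧ * N L″ (x ∸ 1 ∸ 1))) L′)) L
          ≡⟨ sumP-* (x ∸ 1) _ L ⟩
        _ ≡⟨ cong ((x ∸ 1) *_) (sumP-+ (λ u L′ → ⟦ h v u ⟧ * N L′ (x ∸ 1 ∸ 1)) _ L) ⟩
        (x ∸ 1) * (S v + D v w) ∎))))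

  N-↭ : (∀ u v → h u v ≡ h v u) → ∀ {L L′} x → L ↭ L′ → N L x ≡ N L′ x
  N-↭ hs {L} x p = go (length L) x ≤-refl p
    where
    -- Besides the permutation, a bound on the length decreases: below a common head, `sumP-↭` asks
    -- for invariance of `N` on all shorter lists at once.
    go : ∀ n {L L′} x → length L ≤ n → L ↭ L′ → N L x ≡ N L′ x
    prep′ : ∀ n {L L′} v x → length L ≤ n → L ↭ L′ → N (v ∷ L) x ≡ N (v ∷ L′) x
    prep′ n {L} {L′} v x l p = trans (N-cons v L x) (trans
      (cong (x *_) (cong₂ _+_ (go n (x ∸ 1) l p)
        (sumP-↭ n (λ u l′ q → cong (⟦ h v u ⟧ *_) (go n (x ∸ 1) (<⇒≤ l′) q)) l p)))
      (sym (N-cons v L′ x)))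
    go n x l Perm.refl = refl
    go (suc n) x (s≤s l) (prep v p) = prep′ n v x l p
    go (suc (suc n)) x (s≤s (s≤s l)) (swap {xs = L} v w p) = trans (N-swap hs v w L x)
      (prep′ (suc n) w x (s≤s l) (prep v p))
    go n x l (Perm.trans p q) = trans (go n x l p) (go n x (subst (_≤ n) (↭-length p) l) q)

  deg-↭ : ∀ v {L L′} → L ↭ L′ → deg v L ≡ deg v L′
  deg-↭ v Perm.refl        = refl
  deg-↭ v (prep u p)       = cong (⟦ h v u ⟧ +_) (deg-↭ v p)
  deg-↭ v (swap u w p)     = trans (cong (λ s → ⟦ h v u ⟧ + (⟦ h v w ⟧ + s)) (deg-↭ v p))
                                   (+-rotate ⟦ h v u ⟧ ⟦ h v w ⟧ _)
  deg-↭ v (Perm.trans p q) = trans (deg-↭ v p) (deg-↭ v q)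

  sumP-deg : ∀ v {F : V → List V → ℕ} {B} L →
    (∀ u L′ → L ↭ u ∷ L′ → h v u ≡ true → F u L′ ≡ B) →
    sumP (λ u L′ → ⟦ h v u ⟧ * F u L′) L ≡ deg v L * B
  sumP-deg v []      e = refl
  sumP-deg v {F} {B} (u ∷ L) e with h v u in eq
  ... | true  = cong₂ _+_ (trans (+-identityʳ _) (e u L ↭-refl eq))
                  (sumP-deg v L λ w L′ p → e w (u ∷ L′) (bring-front p))
  ... | false = sumP-deg v L λ w L′ p → e w (u ∷ L′) (bring-front p)

  sumP-deg-≤ : ∀ v {F : V → List V → ℕ} {B} L →
    (∀ u L′ → L ↭ u ∷ L′ → h v u ≡ true → F u L′ ≤ B) →
    sumP (λ u L′ → ⟦ h v u ⟧ * F u L′) L ≤ deg v L * B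
  sumP-deg-≤ v []      e = z≤n
  sumP-deg-≤ v {F} {B} (u ∷ L) e with h v u in eq
  ... | true  = +-mono-≤ (≤-trans (≤-reflexive (+-identityʳ _)) (e u L ↭-refl eq))
                  (sumP-deg-≤ v L λ w L′ p → e w (u ∷ L′) (bring-front p))
  ... | false = sumP-deg-≤ v L λ w L′ p → e w (u ∷ L′) (bring-front p)

-- Sums over lists, falling factorials and searching in lists.

∑ : {C : Set} → List C → (C → ℕ) → ℕ
∑ []       f = 0
∑ (c ∷ cs) f = f c + ∑ cs f

module _ {C : Set} where

  ∑-cong : ∀ (cs : List C) {f g : C → ℕ} → (∀ c → f c ≡ g c) → ∑ cs f ≡ ∑ cs g
  ∑-cong []       e = refl
  ∑-cong (c ∷ cs) e = cong₂ _+_ (e c) (∑-cong cs e)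

  ∑-+ : ∀ (cs : List C) (f g : C → ℕ) → ∑ cs (λ c → f c + g c) ≡ ∑ cs f + ∑ cs g
  ∑-+ []       f g = refl
  ∑-+ (c ∷ cs) f g = trans (cong (f c + g c +_) (∑-+ cs f g)) (shuffle (f c) (g c) _ _)
    where
    shuffle : ∀ a b c d → a + b + (c + d) ≡ a + c + (b + d)
    shuffle = solve-∀

  ∑-*ʳ : ∀ (cs : List C) (f : C → ℕ) k → ∑ cs (λ c → f c * k) ≡ ∑ cs f * k
  ∑-*ʳ []       f k = refl
  ∑-*ʳ (c ∷ cs) f k = trans (cong (f c * k +_) (∑-*ʳ cs f k)) (sym (*-distribʳ-+ k (f c) _))

  ∑-*ˡ : ∀ (cs : List C) (f : C → ℕ) k → ∑ cs (λ c → k * f c) ≡ k * ∑ cs f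
  ∑-*ˡ cs f k = trans (∑-cong cs λ c → *-comm k (f c)) (trans (∑-*ʳ cs f k) (*-comm _ k))

  ∑-zero : ∀ (cs : List C) → ∑ cs (λ _ → 0) ≡ 0
  ∑-zero []       = refl
  ∑-zero (c ∷ cs) = ∑-zero cs

  ∑-sumP : ∀ {V : Set} (cs : List C) (F : C → V → List V → ℕ) L →
    ∑ cs (λ c → sumP (F c) L) ≡ sumP (λ u L′ → ∑ cs (λ c → F c u L′)) L
  ∑-sumP cs F []      = ∑-zero cs
  ∑-sumP cs F (u ∷ L) = trans (∑-+ cs _ _)
    (cong (∑ cs (λ c → F c u L) +_) (∑-sumP cs (λ c w L′ → F c w (u ∷ L′)) L))

∑-const : {C : Set} (cs : List C) {f : C → ℕ} {k : ℕ} → (∀ c → c ∈ cs → f c ≡ k) → ∑ cs f ≡ length cs * k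
∑-const []       e = refl
∑-const (c ∷ cs) e = cong₂ _+_ (e c (here refl)) (∑-const cs λ c i → e c (there i))

fall-last : ∀ x m → fall x (suc m) ≡ fall x m * (x ∸ m)
fall-last x zero    = trans (*-identityʳ x) (sym (+-identityʳ x))
fall-last x (suc m) = begin
  x * fall (x ∸ 1) (suc m)            ≡⟨ cong (x *_) (fall-last (x ∸ 1) m) ⟩
  x * (fall (x ∸ 1) m * (x ∸ 1 ∸ m))  ≡⟨ *-assoc x _ _ ⟨
  x * fall (x ∸ 1) m * (x ∸ 1 ∸ m)    ≡⟨ cong (x * fall (x ∸ 1) m *_) (∸-+-assoc x 1 m) ⟩
  x * fall (x ∸ 1) m * (x ∸ suc m)    ∎
  where open ≡-Reasoning

fall-zero : ∀ {x m} → x < m → fall x m ≡ 0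
fall-zero {zero}  (s≤s l)       = refl
fall-zero {suc x} (s≤s (s≤s l)) = trans (cong (suc x *_) (fall-zero (s≤s l))) (*-zeroʳ (suc x))

fall-pos : ∀ {x m} → m ≤ x → 0 < fall x m
fall-pos {m = zero}      _       = s≤s z≤n
fall-pos {suc x} {suc m} (s≤s l) = *-mono-< (s≤s (z≤n {x})) (fall-pos l)

search : {V : Set} {Q : V → Set} → Decidable Q → ∀ L → (∃ λ v → v ∈ L × Q v) ⊎ (∀ v → v ∈ L → ¬ Q v)
search Q? []      = inj₂ λ _ ()
search Q? (v ∷ L) with Q? v | search Q? L
... | yes q | _                = inj₁ (v , here refl , q)
... | no ¬q | inj₁ (u , i , q) = inj₁ (u , there i , q)
... | no ¬q | inj₂ none        = inj₂ λ { _ (here refl) → ¬q ; u (there i) → none u i }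

∈⇒↭ : {V : Set} {u : V} {L : List V} → u ∈ L → ∃ λ L′ → L ↭ u ∷ L′
∈⇒↭ {L = _ ∷ L} (here refl) = L , ↭-refl
∈⇒↭ {L = v ∷ _} (there i)   with L′ , p ← ∈⇒↭ i = v ∷ L′ , bring-front p

-- Matchings in a triangle-free graph.

module TriangleFree {V : Set} (h : V → V → Bool) (h-sym : ∀ u v → h u v ≡ h v u)
  (tri : ∀ {u v w} → h u v ≡ true → h v w ≡ true → h u w ≡ true → ⊥) where

  open Count h public

  flip : ∀ {u v} → h u v ≡ true → h v u ≡ true
  flip {u} {v} e = trans (h-sym v u) e

  h-irrefl : ∀ v → h v v ≡ false
  h-irrefl v with h v v in e
  ... | true  = ⊥-elim (tri e e e)
  ... | false = refl

  at-most-one : ∀ {a b} v → h a b ≡ true → ⟦ h v a ⟧ + ⟦ h v b ⟧ ≤ 1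
  at-most-one {a} {b} v e with h v a in p | h v b in q
  ... | false | false = z≤n
  ... | false | true  = ≤-refl
  ... | true  | false = ≤-refl
  ... | true  | true  = ⊥-elim (tri p e q)

  deg-self : ∀ v L → deg v (v ∷ L) ≡ deg v L
  deg-self v L = cong (λ b → ⟦ b ⟧ + deg v L) (h-irrefl v)

  neighbour : ∀ v L → 0 < deg v L → ∃₂ λ u L′ → L ↭ u ∷ L′ × h v u ≡ true
  neighbour v (u ∷ L) l with h v u in e
  ... | true  = u , L , ↭-refl , e
  ... | false with w , L′ , p , e′ ← neighbour v L l = w , u ∷ L′ , bring-front p , e′

  deg-pos : ∀ {v u L} → u ∈ L → h v u ≡ true → 0 < deg v L
  deg-pos {v} {u} i e with L′ , p ← ∈⇒↭ i =
    subst (0 <_) (sym (deg-↭ v p)) (subst (λ b → 0 < ⟦ b ⟧ + deg v L′) (sym e) (s≤s z≤n))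

  -- The leftover list is arbitrary, so `¬ Mat (suc d) L` expresses that the matching number is at
  -- most `d`, and `¬ Mat 1 L` that `L` is independent for `h`, hence a clique of the complementary
  -- graph.
  data Mat : ℕ → List V → Set where
    empty : ∀ {L} → Mat 0 L
    pair : ∀ {j L u w L′} → L ↭ u ∷ w ∷ L′ → h u w ≡ true → Mat j L′ → Mat (suc j) L

  Mat-↭ : ∀ {j L L′} → L ↭ L′ → Mat j L → Mat j L′
  Mat-↭ p empty         = empty
  Mat-↭ p (pair q e m) = pair (↭-trans (↭-sym p) q) e m

  front₂ : ∀ {v u w : V} {L L′} → L ↭ u ∷ w ∷ L′ → v ∷ L ↭ u ∷ w ∷ v ∷ L′
  front₂ {v} {u} {w} p = ↭-trans (bring-front p) (prep u (swap v w ↭-refl))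

  Mat-weaken : ∀ {j v L} → Mat j L → Mat j (v ∷ L)
  Mat-weaken empty         = empty
  Mat-weaken (pair p e m) = pair (front₂ p) e (Mat-weaken m)

  Mat-length : ∀ {j L} → Mat j L → j + j ≤ length L
  Mat-length empty = z≤n
  Mat-length {suc j} (pair p e m) = subst (suc (j + suc j) ≤_) (sym (↭-length p))
    (s≤s (≤-trans (≤-reflexive (+-suc j j)) (s≤s (Mat-length m))))

  -- The neighbours of v form an independent set, so each pair of the matching covers at most one.
  Mat-extend : ∀ {j v L} → Mat j L → j < deg v L → Mat (suc j) (v ∷ L)
  Mat-extend {v = v} {L} empty l with u , L′ , p , e ← neighbour v L l = pair (prep v p) e empty
  Mat-extend {suc j} {v} {L} (pair {u = u} {w} {L′} p e m) l =
    pair (front₂ p) e (Mat-extend m (+-cancelˡ-≤ 1 _ _ (≤-trans (subst (suc (suc j) ≤_) split l)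
      (+-monoˡ-≤ (deg v L′) (at-most-one v e)))))
    where
    split : deg v L ≡ ⟦ h v u ⟧ + ⟦ h v w ⟧ + deg v L′
    split = trans (deg-↭ v p) (sym (+-assoc ⟦ h v u ⟧ ⟦ h v w ⟧ _))

  Mat-1 : ∀ {v L} → v ∈ L → 0 < deg v L → Mat 1 L
  Mat-1 {v} {L} i l with M , p ← ∈⇒↭ i =
    Mat-↭ (↭-sym p) (Mat-extend empty (subst (0 <_) (trans (deg-↭ v p) (deg-self v M)) l))

  indep-cons : ∀ {v L} → ¬ Mat 1 L → ¬ (0 < deg v L) → ¬ Mat 1 (v ∷ L)
  indep-cons {v} {L} ¬m ¬d (pair {u = a} {b} {M} p e _) =
    go (∈-resp-↭ (↭-sym p) (here refl)) (∈-resp-↭ (↭-sym p) (there (here refl)))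
    where
    go : a ∈ v ∷ L → b ∈ v ∷ L → ⊥
    go (here refl) (here refl) = tri e e e
    go (here refl) (there j)   = ¬d (deg-pos j e)
    go (there i)   (here refl) = ¬d (deg-pos i (flip e))
    go (there i)   (there j)   = ¬m (Mat-1 i (deg-pos j e))

  isolated⇒indep : ∀ L → (∀ v → v ∈ L → ¬ (0 < deg v L)) → ¬ Mat 1 L
  isolated⇒indep L iso (pair {u = a} {b} p e _) =
    iso a (∈-resp-↭ (↭-sym p) (here refl)) (deg-pos (∈-resp-↭ (↭-sym p) (there (here refl))) e)

  -- Greedy choice: pair the first entry with any neighbour. By triangle-freeness every other entry
  -- is related to at most one of the two, so the minimum degree drops by at most one and the choice
  -- can be repeated.
  min-degree⇒Mat : ∀ d L → 0 < length L → (∀ v → v ∈ L → d < deg v L) → Mat (suc d) L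
  min-degree⇒Mat d L@(v ∷ _) _ δ with w , L₁ , p , e ← neighbour v L (≤-trans (s≤s z≤n) (δ v (here refl)))
    with ∈-resp-↭ p (here refl)
  ... | here refl = ⊥-elim (tri e e e)
  ... | there i with L₂ , q ← ∈⇒↭ i = pair r e (rest d δ)
    where
    r : L ↭ v ∷ w ∷ L₂
    r = ↭-trans p (bring-front q)
    split : ∀ z → deg z L ≡ ⟦ h z v ⟧ + ⟦ h z w ⟧ + deg z L₂
    split z = trans (deg-↭ z r) (sym (+-assoc ⟦ h z v ⟧ ⟦ h z w ⟧ _))
    loss : ∀ {d} z → suc d ≤ deg z L → d ≤ deg z L₂
    loss {d} z l = +-cancelˡ-≤ 1 _ _ (≤-trans (subst (suc d ≤_) (split z) l)
      (+-monoˡ-≤ (deg z L₂) (at-most-one z e)))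
    nonempty : ∀ {z} M → 0 < deg z M → 0 < length M
    nonempty (_ ∷ _) _ = s≤s z≤n
    rest : ∀ d → (∀ z → z ∈ L → d < deg z L) → Mat d L₂
    rest zero    δ = empty
    rest (suc d) δ = min-degree⇒Mat d L₂
      (nonempty L₂ (≤-trans (s≤s z≤n) (loss v (δ v (here refl)))))
      (λ z i → loss z (δ z (∈-resp-↭ (↭-sym r) (there (there i)))))

  low-degree : ∀ d L → 0 < length L → ¬ Mat (suc d) L → ∃₂ λ v L′ → L ↭ v ∷ L′ × deg v L′ ≤ d
  low-degree d L l ¬m with search (λ v → deg v L ≤? d) L
  ... | inj₂ none = ⊥-elim (¬m (min-degree⇒Mat d L l λ v i → ≰⇒> (none v i)))
  ... | inj₁ (v , i , q) with L′ , p ← ∈⇒↭ i =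
    v , L′ , p , subst (_≤ d) (trans (deg-↭ v p) (deg-self v L′)) q

  N-indep : ∀ L x → ¬ Mat 1 L → N L x ≡ fall x (length L)
  N-indep []      x ¬m = refl
  N-indep (v ∷ L) x ¬m = trans (N-cons v L x) (cong (x *_) (trans
    (cong₂ _+_ (N-indep L (x ∸ 1) (¬m ∘ Mat-weaken))
      (sumP-deg v {B = 0} L λ u L′ p e → ⊥-elim (¬m (pair (prep v p) e empty))))
    (trans (cong (fall (x ∸ 1) (length L) +_) (*-zeroʳ (deg v L))) (+-identityʳ _))))

  -- Either `c` is a block of its own, which makes `length K + 1` blocks, or it joins one of its
  -- `deg c K` neighbours, which makes `length K`.
  N-star : ∀ c K x → ¬ Mat 1 K → N (c ∷ K) x ≡ fall x (length K) * ((x ∸ length K) + deg c K)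
  N-star c []      x ¬m = trans (*-identityʳ x) (sym (trans (+-identityʳ (x + 0)) (+-identityʳ x)))
  N-star c K@(s ∷ K′) x ¬m = begin
    N (c ∷ K) x
      ≡⟨ N-cons c K x ⟩
    x * (N K (x ∸ 1) + sumP (λ u L′ → ⟦ h c u ⟧ * N L′ (x ∸ 1)) K)
      ≡⟨ cong (x *_) (cong₂ _+_ (N-indep K (x ∸ 1) ¬m) (sumP-deg c K λ u L′ p _ →
           trans (N-indep L′ (x ∸ 1) (λ m → ¬m (Mat-↭ (↭-sym p) (Mat-weaken m))))
                 (cong (fall (x ∸ 1)) (suc-injective (sym (↭-length p)))))) ⟩
    x * (fall (x ∸ 1) (suc m) + deg c K * fall (x ∸ 1) m)
      ≡⟨ cong (λ s → x * (s + deg c K * fall (x ∸ 1) m)) (fall-last (x ∸ 1) m) ⟩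
    x * (fall (x ∸ 1) m * (x ∸ 1 ∸ m) + deg c K * fall (x ∸ 1) m)
      ≡⟨ factor x (fall (x ∸ 1) m) (x ∸ 1 ∸ m) (deg c K) ⟩
    x * fall (x ∸ 1) m * ((x ∸ 1 ∸ m) + deg c K)
      ≡⟨ cong (λ s → x * fall (x ∸ 1) m * (s + deg c K)) (∸-+-assoc x 1 m) ⟩
    fall x (suc m) * ((x ∸ suc m) + deg c K) ∎
    where
    open ≡-Reasoning
    m = length K′
    factor : ∀ x f a q → x * (f * a + q * f) ≡ x * f * (a + q)
    factor = solve-∀

  -- If both ends of a pair `u`-`w` had a further neighbour, these neighbours would differ, since a
  -- common one closes a triangle, and two disjoint pairs would arise. So one end of the pair meets
  -- all pairs.
  star : ∀ L → 0 < length L → ¬ Mat 2 L → ∃₂ λ c K → L ↭ c ∷ K × ¬ Mat 1 K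
  star L@(a ∷ M) l ¬m with search (λ v → 0 <? deg v L) L
  ... | inj₂ iso = a , M , ↭-refl , isolated⇒indep L iso ∘ Mat-weaken
  ... | inj₁ (v , i , d) with pair {u = u} {w} {L′} p e _ ← Mat-1 i d with 0 <? deg w L′ | 0 <? deg u L′
  ...   | no ¬dw | _      = u , w ∷ L′ , p , indep-cons (λ m → ¬m (pair p e m)) ¬dw
  ...   | yes _  | no ¬du = w , u ∷ L′ , ↭-trans p (swap u w ↭-refl) , indep-cons (λ m → ¬m (pair p e m)) ¬du
  ...   | yes dw | yes du with y , L₁ , q , f ← neighbour u L′ du with h w y in g
  ...     | true  = ⊥-elim (tri e g f)
  ...     | false with t , L₂ , r , k ← neighbour w L₁ (subst (0 <_) (trans (deg-↭ w q) (cong (λ b → ⟦ b ⟧ + deg w L₁) g)) dw) =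
    ⊥-elim (¬m (pair (↭-trans p (prep u (bring-front q))) f (pair (prep w r) k empty)))

  -- The general bound `(x)ₖ (x)_d`.

  N-delete : ∀ {L v L′} x {A B} → L ↭ v ∷ L′ → N L′ (x ∸ 1) ≤ A →
    (∀ u L″ → L′ ↭ u ∷ L″ → h v u ≡ true → N L″ (x ∸ 1) ≤ B) →
    N L x ≤ x * (A + deg v L′ * B)
  N-delete {L} {v} {L′} x p a b = ≤-trans
    (≤-reflexive (trans (N-↭ h-sym x p) (N-cons v L′ x)))
    (*-monoʳ-≤ x (+-mono-≤ a (sumP-deg-≤ v L′ b)))

  Bounded : ℕ → Set
  Bounded n = ∀ k d L x → length L ≡ k + d → k + d ≤ n → d ≤ k → ¬ Mat (suc d) L →
    N L x ≤ fall x k * fall x d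

  module _ {n} (bounded : Bounded n) where

    private
      shorter : ∀ k d {L : List V} {v L′} → L ↭ v ∷ L′ → length L ≡ suc (k + d) → length L′ ≡ k + d
      shorter k d p l = suc-injective (trans (sym (↭-length p)) l)

    -- Here the deletion of `v` lowers the matching number, so `L′` has the parameters `suc k` and
    -- `d`: the complementary graph without `v` still needs `suc k` colours. The lists `L″` have the
    -- parameters `k` and `d`, because the pair `v`-`u` enlarges every matching of `L″`.
    N-delete-noncritical : ∀ k d {L v L′} x → length L ≡ suc k + suc d → k + suc d ≤ n → d ≤ k →
      ¬ Mat (suc (suc d)) L → L ↭ v ∷ L′ → ¬ Mat (suc d) L′ →
      N L x ≤ fall x (suc k) * (fall (x ∸ 1) d * ((x ∸ suc k) + deg v L′))
    N-delete-noncritical k d {L} {v} {L′} x l b d≤k ¬m p ¬m′ = ≤-trans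
      (N-delete x p
        (bounded (suc k) d L′ (x ∸ 1) (trans l′ (+-suc k d)) (subst (_≤ n) (+-suc k d) b) (m≤n⇒m≤1+n d≤k) ¬m′)
        (λ u L″ q e → bounded k d L″ (x ∸ 1) (suc-injective (trans (sym (↭-length q)) (trans l′ (+-suc k d))))
          (≤-trans (+-monoʳ-≤ k (n≤1+n d)) b) d≤k
          (λ m → ¬m (pair (↭-trans p (prep v q)) e m))))
      (≤-reflexive (begin
        x * (fall (x ∸ 1) (suc k) * F + deg v L′ * (fall (x ∸ 1) k * F))
          ≡⟨ cong (λ s → x * (s * F + deg v L′ * (fall (x ∸ 1) k * F))) (fall-last (x ∸ 1) k) ⟩
        x * (fall (x ∸ 1) k * (x ∸ 1 ∸ k) * F + deg v L′ * (fall (x ∸ 1) k * F))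
          ≡⟨ factor x (fall (x ∸ 1) k) (x ∸ 1 ∸ k) F (deg v L′) ⟩
        x * fall (x ∸ 1) k * (F * ((x ∸ 1 ∸ k) + deg v L′))
          ≡⟨ cong (λ s → x * fall (x ∸ 1) k * (F * (s + deg v L′))) (∸-+-assoc x 1 k) ⟩
        fall x (suc k) * (F * ((x ∸ suc k) + deg v L′)) ∎))
      where
      open ≡-Reasoning
      F = fall (x ∸ 1) d
      l′ = shorter k (suc d) p l
      factor : ∀ x f a F q → x * (f * a * F + q * (f * F)) ≡ x * f * (F * (a + q))
      factor = solve-∀

    -- Now `L′` merely inherits the matching bound `suc d`, so it is the first parameter that drops
    -- to `k`; the hypothesis `suc d ≤ k` is what `Bounded` demands of the new parameters.
    N-delete-critical : ∀ k d {L v L′} x → length L ≡ suc k + suc d → k + suc d ≤ n → suc d ≤ k →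
      ¬ Mat (suc (suc d)) L → L ↭ v ∷ L′ →
      N L x ≤ fall x (suc k) * (fall (x ∸ 1) d * ((x ∸ suc d) + deg v L′))
    N-delete-critical k d {L} {v} {L′} x l b d<k ¬m p = ≤-trans
      (N-delete x p
        (bounded k (suc d) L′ (x ∸ 1) l′ b d<k (λ m → ¬m (Mat-↭ (↭-sym p) (Mat-weaken m))))
        (λ u L″ q e → bounded k d L″ (x ∸ 1) (suc-injective (trans (sym (↭-length q)) (trans l′ (+-suc k d))))
          (≤-trans (+-monoʳ-≤ k (n≤1+n d)) b) (<⇒≤ d<k)
          (λ m → ¬m (pair (↭-trans p (prep v q)) e m))))
      (≤-reflexive (begin
        x * (f * fall (x ∸ 1) (suc d) + deg v L′ * (f * F))
          ≡⟨ cong (λ s → x * (f * s + deg v L′ * (f * F))) (fall-last (x ∸ 1) d) ⟩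
        x * (f * (F * (x ∸ 1 ∸ d)) + deg v L′ * (f * F))
          ≡⟨ factor x f (x ∸ 1 ∸ d) F (deg v L′) ⟩
        x * f * (F * ((x ∸ 1 ∸ d) + deg v L′))
          ≡⟨ cong (λ s → x * f * (F * (s + deg v L′))) (∸-+-assoc x 1 d) ⟩
        x * f * (F * ((x ∸ suc d) + deg v L′)) ∎))
      where
      open ≡-Reasoning
      F = fall (x ∸ 1) d
      f = fall (x ∸ 1) k
      l′ = shorter k (suc d) p l
      factor : ∀ x f a F q → x * (f * (F * a) + q * (f * F)) ≡ x * f * (F * (a + q))
      factor = solve-∀

  -- Equality holds for the disjoint union of two cliques of sizes k and d.
  N-bound : ∀ n → Bounded n
  N-bound n k zero L x l b d≤k ¬m = ≤-reflexive (trans (N-indep L x ¬m)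
    (trans (cong (fall x) (trans l (+-identityʳ k))) (sym (*-identityʳ _))))
  N-bound (suc n) (suc k) (suc d) L x l (s≤s b) (s≤s d≤k) ¬m
    with v , L′ , p , D ← low-degree (suc d) L (subst (0 <_) (sym l) (s≤s z≤n)) ¬m =
    -- Whether `L′` has a matching of `suc d` pairs is never decided; an inequality between natural
    -- numbers is stable under double negation, so a classical case distinction is enough.
    decidable-stable (_ ≤? _) λ ¬goal → ¬¬-excluded-middle λ
      { (no ¬m′) → ¬goal (finish (suc k) (s≤s d≤k) ≤-refl
          (N-delete-noncritical (N-bound n) k d x l b d≤k ¬m p ¬m′))
      ; (yes m)  → ¬goal (finish (suc d) ≤-refl (s≤s d≤k)
          (N-delete-critical (N-bound n) k d x l b (room m) ¬m p)) }
    where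
    -- `suc d` disjoint pairs fit into `k + suc d` entries only if `suc d ≤ k`.
    room : Mat (suc d) L′ → suc d ≤ k
    room m = +-cancelʳ-≤ (suc d) _ _
      (subst (suc d + suc d ≤_) (suc-injective (trans (sym (↭-length p)) l)) (Mat-length m))
    -- In both cases `deg v L′ ≤ suc d ≤ j`, so `(x ∸ j) + deg v L′` is at most `x` as soon as
    -- `j ≤ x`. For `x ≤ k` the factor `fall x (suc k)` makes both sides vanish, which disposes of
    -- the truncated subtraction.
    finish : ∀ j → suc d ≤ j → j ≤ suc k →
      N L x ≤ fall x (suc k) * (fall (x ∸ 1) d * ((x ∸ j) + deg v L′)) →
      N L x ≤ fall x (suc k) * fall x (suc d)
    finish j d<j j≤k bd with suc k ≤? x
    ... | no x<k = ≤-trans bd (≤-reflexive (trans (vanish _) (sym (vanish _))))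
      where
      vanish : ∀ c → fall x (suc k) * c ≡ 0
      vanish c = cong (_* c) (fall-zero (≰⇒> x<k))
    ... | yes k≤x = ≤-trans bd (*-monoʳ-≤ (fall x (suc k)) (≤-trans
      (*-monoʳ-≤ (fall (x ∸ 1) d) (≤-trans (+-monoʳ-≤ (x ∸ j) (≤-trans D d<j))
        (≤-reflexive (m∸n+n≡m (≤-trans j≤k k≤x)))))
      (≤-reflexive (*-comm (fall (x ∸ 1) d) x))))

  -- Excess three: degree counting, cubic graphs and joins.

  deg-++ : ∀ v K R → deg v (K ++ R) ≡ deg v K + deg v R
  deg-++ v []      R = refl
  deg-++ v (u ∷ K) R = trans (cong (⟦ h v u ⟧ +_) (deg-++ v K R)) (sym (+-assoc ⟦ h v u ⟧ _ _))

  deg≤length : ∀ v L → deg v L ≤ length L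
  deg≤length v []      = z≤n
  deg≤length v (u ∷ L) with h v u
  ... | true  = s≤s (deg≤length v L)
  ... | false = m≤n⇒m≤1+n (deg≤length v L)

  deg-full : ∀ v L → length L ≤ deg v L → ∀ {u} → u ∈ L → h v u ≡ true
  deg-full v (u ∷ L) l i with h v u in e
  ... | false = ⊥-elim (<-irrefl refl (≤-trans l (deg≤length v L)))
  deg-full v (u ∷ L) (s≤s l) (here refl) | true = e
  deg-full v (u ∷ L) (s≤s l) (there i)   | true = deg-full v L l i

  neighbourhood : ∀ v L → ∃₂ λ K R → L ↭ K ++ R × (∀ {u} → u ∈ K → h v u ≡ true) × length K ≡ deg v L
  neighbourhood v []      = [] , [] , ↭-refl , (λ ()) , refl
  neighbourhood v (u ∷ L) with h v u in e | neighbourhood v L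
  ... | true  | K , R , p , f , l = u ∷ K , R , prep u p , (λ { (here refl) → e ; (there i) → f i }) , cong suc l
  ... | false | K , R , p , f , l = K , u ∷ R , ↭-trans (prep u p) (↭-sym (shift u K R)) , f , l

  handshake : ∀ L → ∃ λ e → ∑ L (λ v → deg v L) ≡ e + e
  handshake []      = 0 , refl
  handshake (v ∷ L) with e , q ← handshake L = deg v L + e , (begin
    deg v (v ∷ L) + ∑ L (λ u → ⟦ h u v ⟧ + deg u L)
      ≡⟨ cong₂ _+_ (deg-self v L) (∑-+ L _ _) ⟩
    deg v L + (∑ L (λ u → ⟦ h u v ⟧) + ∑ L (λ u → deg u L))
      ≡⟨ cong₂ (λ s t → deg v L + (s + t)) (∑-h L) q ⟩
    deg v L + (deg v L + (e + e))
      ≡⟨ shuffle (deg v L) e ⟩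
    deg v L + e + (deg v L + e) ∎)
    where
    open ≡-Reasoning
    shuffle : ∀ d e → d + (d + (e + e)) ≡ d + e + (d + e)
    shuffle = solve-∀
    ∑-h : ∀ L → ∑ L (λ u → ⟦ h u v ⟧) ≡ deg v L
    ∑-h []      = refl
    ∑-h (u ∷ L) = cong₂ (λ b s → ⟦ b ⟧ + s) (h-sym u v) (∑-h L)

  -- The degrees would sum to the odd number 21.
  cubic-length≢7 : ∀ L → (∀ v → v ∈ L → deg v L ≡ 3) → length L ≢ 7
  cubic-length≢7 L cub l with e , q ← handshake L = odd e (trans (sym (cong (_* 3) l)) (trans (sym (∑-const L cub)) q))
    where
    odd : ∀ e → 21 ≢ e + e
    odd e eq with e ≤? 10
    ... | yes e≤10 = <⇒≢ (s≤s (+-mono-≤ e≤10 e≤10)) (sym eq)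
    ... | no e≰10  = <⇒≢ (+-mono-≤ (≰⇒> e≰10) (≰⇒> e≰10)) eq

  module Cubic {L} (cub : ∀ v → v ∈ L → deg v L ≡ 3) (¬4 : ¬ Mat 4 L) where

    -- Three matched pairs, two entries `u` and `u′` that they leave uncovered, and the rest. A
    -- fourth disjoint pair is excluded by `¬4`, which makes this matching maximum.
    Layout : (a b a′ b′ a″ b″ u u′ : V) → List V → Set
    Layout a b a′ b′ a″ b″ u u′ M = L ↭ a ∷ b ∷ a′ ∷ b′ ∷ a″ ∷ b″ ∷ u ∷ u′ ∷ M

    module _ {a b a′ b′ a″ b″ u u′ M} (p : Layout a b a′ b′ a″ b″ u u′ M)
      (e : h a b ≡ true) (e′ : h a′ b′ ≡ true) (e″ : h a″ b″ ≡ true) where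

      member : ∀ {w} → w ∈ a ∷ b ∷ a′ ∷ b′ ∷ a″ ∷ b″ ∷ u ∷ u′ ∷ M → w ∈ L
      member = ∈-resp-↭ (↭-sym p)

      degree : ∀ {w} → w ∈ a ∷ b ∷ a′ ∷ b′ ∷ a″ ∷ b″ ∷ u ∷ u′ ∷ M →
        deg w (a ∷ b ∷ a′ ∷ b′ ∷ a″ ∷ b″ ∷ u ∷ u′ ∷ M) ≡ 3
      degree {w} i = trans (sym (deg-↭ w p)) (cub w (member i))

      -- a–u and b–w would replace the pair a–b.
      no-augment : h u a ≡ true → ¬ (0 < deg b (u′ ∷ M))
      no-augment ua d with w , M′ , q , bw ← neighbour b (u′ ∷ M) d =
        ¬4 (pair p′ (flip ua) (pair ↭-refl bw (pair ↭-refl e′ (pair ↭-refl e″ empty))))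
        where
        p′ : L ↭ a ∷ u ∷ b ∷ w ∷ a′ ∷ b′ ∷ a″ ∷ b″ ∷ M′
        p′ = ↭-trans p (prep a (↭-trans
          (shifts (b ∷ a′ ∷ b′ ∷ a″ ∷ b″ ∷ []) (u ∷ [])) (prep u (prep b
          (↭-trans (++⁺ˡ (a′ ∷ b′ ∷ a″ ∷ b″ ∷ []) q) (shifts (a′ ∷ b′ ∷ a″ ∷ b″ ∷ []) (w ∷ [])))))))

      -- The neighbours `b`, `u` and `u′` already exhaust the degree three of `a`.
      saturated : h u a ≡ true → h u′ a ≡ true → h a b′ ≡ false × h a b″ ≡ false
      saturated ua u′a with degree (here refl)
      ... | eq rewrite e | flip ua | flip u′a with h a b′ | h a b″
      ... | false | false = refl , refl
      ... | true  | s     = ⊥-elim (too-many ⟦ h a a ⟧ ⟦ h a a′ ⟧ ⟦ h a a″ ⟧ ⟦ s ⟧ (deg a M) eq)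
        where
        too-many : ∀ i j k s m → i + (1 + (j + (1 + (k + (s + (1 + (1 + m))))))) ≢ 3
        too-many i j k s m eq = case trans (sym (rearrange i j k s m)) eq of λ ()
          where
          rearrange : ∀ i j k s m → i + (1 + (j + (1 + (k + (s + (1 + (1 + m))))))) ≡ 4 + (i + j + k + s + m)
          rearrange = solve-∀
      ... | false | true  = ⊥-elim (too-many ⟦ h a a ⟧ ⟦ h a a′ ⟧ ⟦ h a a″ ⟧ (deg a M) eq)
        where
        too-many : ∀ i j k m → i + (1 + (j + (0 + (k + (1 + (1 + (1 + m))))))) ≢ 3
        too-many i j k m eq = case trans (sym (rearrange i j k m)) eq of λ ()
          where
          rearrange : ∀ i j k m → i + (1 + (j + (0 + (k + (1 + (1 + (1 + m))))))) ≡ 4 + (i + j + k + m)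
          rearrange = solve-∀

      no-common : h u a ≡ true → h b u ≡ false
      no-common ua with h b u in q
      ... | true  = ⊥-elim (tri ua e (flip q))
      ... | false = refl

      -- Besides `a`, the entry `b` has two more neighbours. Among the candidates, `u` would close a
      -- triangle, `u′` and the entries of `M` would augment the matching, and `a′`, `a″` are
      -- excluded by hypothesis; only `b′` and `b″` remain.
      partners-adjacent : h u a ≡ true → h a′ b ≡ false → h a″ b ≡ false → h b b′ ≡ true × h b b″ ≡ true
      partners-adjacent ua a′b a″b with degree (there (here refl))
      ... | eq rewrite flip e | h-irrefl b | trans (h-sym b a′) a′b | trans (h-sym b a″) a″b
                     | no-common ua | n≤0⇒n≡0 (≮⇒≥ (no-augment ua)) with h b b′ | h b b″
      ... | true  | true  = refl , refl
      ... | true  | false = case eq of λ ()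
      ... | false | true  = case eq of λ ()
      ... | false | false = case eq of λ ()

      -- All of the degree three of `w` comes from three pairs, and each contributes at most one.
      one-each : ∀ w → w ∈ L → deg w (u ∷ u′ ∷ M) ≡ 0 →
        ⟦ h w a ⟧ + ⟦ h w b ⟧ ≡ 1 × ⟦ h w a′ ⟧ + ⟦ h w b′ ⟧ ≡ 1 × ⟦ h w a″ ⟧ + ⟦ h w b″ ⟧ ≡ 1
      one-each w i z = ones (at-most-one w e) (at-most-one w e′) (at-most-one w e″)
        (trans (regroup ⟦ h w a ⟧ ⟦ h w b ⟧ ⟦ h w a′ ⟧ ⟦ h w b′ ⟧ ⟦ h w a″ ⟧ ⟦ h w b″ ⟧) (trans (cong (λ s → ⟦ h w a ⟧ + (⟦ h w b ⟧ + (⟦ h w a′ ⟧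
          + (⟦ h w b′ ⟧ + (⟦ h w a″ ⟧ + (⟦ h w b″ ⟧ + s)))))) (sym z)) (trans (sym (deg-↭ w p)) (cub w i))))
        where
        regroup : ∀ a b c d e f → (a + b) + ((c + d) + (e + f)) ≡ a + (b + (c + (d + (e + (f + 0)))))
        regroup = solve-∀
        ones : ∀ {r s t} → r ≤ 1 → s ≤ 1 → t ≤ 1 → r + (s + t) ≡ 3 → r ≡ 1 × s ≡ 1 × t ≡ 1
        ones (s≤s z≤n) (s≤s z≤n) (s≤s z≤n) _ = refl , refl , refl
        ones (s≤s z≤n) (s≤s z≤n) z≤n       ()
        ones (s≤s z≤n) z≤n       (s≤s z≤n) ()
        ones (s≤s z≤n) z≤n       z≤n       ()
        ones z≤n       (s≤s z≤n) (s≤s z≤n) ()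
        ones z≤n       (s≤s z≤n) z≤n       ()
        ones z≤n       z≤n       (s≤s z≤n) ()
        ones z≤n       z≤n       z≤n       ()

      rest-isolated : ∀ w → w ∈ u ∷ u′ ∷ M → deg w (u ∷ u′ ∷ M) ≡ 0
      rest-isolated w i with 0 <? deg w (u ∷ u′ ∷ M)
      ... | no ¬d = n≤0⇒n≡0 (≮⇒≥ ¬d)
      ... | yes d = ⊥-elim (¬4 (pair p e (pair ↭-refl e′ (pair ↭-refl e″ (Mat-1 i d)))))

    either : ∀ {p q} → ⟦ p ⟧ + ⟦ q ⟧ ≡ 1 → p ≡ true ⊎ q ≡ true
    either {true}         _ = inj₁ refl
    either {false} {true} _ = inj₂ refl

    module _ {a b a′ b′ a″ b″ u u′ M} (p : Layout a b a′ b′ a″ b″ u u′ M)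
      (e : h a b ≡ true) (e′ : h a′ b′ ≡ true) (e″ : h a″ b″ ≡ true)
      (ua : h u a ≡ true) (ua′ : h u a′ ≡ true) (ua″ : h u a″ ≡ true) where

      private
        p′ : Layout a′ b′ a b a″ b″ u u′ M
        p′ = ↭-trans p (shifts (a ∷ b ∷ []) (a′ ∷ b′ ∷ []))
        p″ : Layout a″ b″ a b a′ b′ u u′ M
        p″ = ↭-trans p (shifts (a ∷ b ∷ a′ ∷ b′ ∷ []) (a″ ∷ b″ ∷ []))

        pick : ∀ {a b} → ⟦ h u′ a ⟧ + ⟦ h u′ b ⟧ ≡ 1 → ¬ (0 < deg b (u′ ∷ M)) → h u′ a ≡ true
        pick s ¬d with either s
        ... | inj₁ q = q
        ... | inj₂ q = ⊥-elim (¬d (deg-pos {L = u′ ∷ M} (here refl) (flip q)))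

      -- An edge from `u′` to `b`, `b′` or `b″` would augment the matching, so `u′` is related to
      -- the same ends `a`, `a′`, `a″` as `u`. These ends are then saturated, which forces the
      -- opposite ends `b`, `b′`, `b″` to be mutually related: a triangle.
      oriented-absurd : ⊥
      oriented-absurd
        with s , s′ , s″ ← one-each p e e′ e″ u′ (∈-resp-↭ (↭-sym p) (∈-++⁺ʳ (a ∷ b ∷ a′ ∷ b′ ∷ a″ ∷ b″ ∷ u ∷ []) (here refl)))
               (rest-isolated p e e′ e″ u′ (there (here refl)))
        with u′a  ← pick s  (no-augment p  e  e′ e″ ua)
           | u′a′ ← pick s′ (no-augment p′ e′ e  e″ ua′)
           | u′a″ ← pick s″ (no-augment p″ e″ e  e′ ua″)
        with ab′ , ab″ ← saturated p  e  e′ e″ ua  u′a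
           | a′b , a′b″ ← saturated p′ e′ e  e″ ua′ u′a′
           | a″b , a″b′ ← saturated p″ e″ e  e′ ua″ u′a″
        with bb′ , bb″ ← partners-adjacent p  e  e′ e″ ua  a′b a″b
           | _ , b′b″  ← partners-adjacent p′ e′ e  e″ ua′ ab′ a″b′
        = tri bb′ b′b″ bb″

    orient : ∀ u {a b} → h a b ≡ true → ⟦ h u a ⟧ + ⟦ h u b ⟧ ≡ 1 →
      ∃₂ λ a′ b′ → h a′ b′ ≡ true × h u a′ ≡ true × (∀ {M} → a ∷ b ∷ M ↭ a′ ∷ b′ ∷ M)
    orient u {a} {b} e s with either s
    ... | inj₁ q = a , b , e , q , ↭-refl
    ... | inj₂ q = b , a , flip e , q , swap a b ↭-refl

    cubic-absurd : 8 ≤ length L → ⊥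
    cubic-absurd l with min-degree⇒Mat 2 L (≤-trans (s≤s z≤n) l) (λ v i → ≤-reflexive (sym (cub v i)))
    ... | pair {u = a} {b} p e (pair {u = a′} {b′} p′ e′ (pair {u = a″} {b″} {R} p″ e″ _)) = go R q (subst (8 ≤_) (↭-length q) l)
      where
      q : L ↭ a ∷ b ∷ a′ ∷ b′ ∷ a″ ∷ b″ ∷ R
      q = ↭-trans p (prep a (prep b (↭-trans p′ (prep a′ (prep b′ p″)))))
      go : ∀ R → L ↭ a ∷ b ∷ a′ ∷ b′ ∷ a″ ∷ b″ ∷ R → 8 ≤ 6 + length R → ⊥
      go []           q (s≤s (s≤s (s≤s (s≤s (s≤s (s≤s ()))))))
      go (u ∷ [])     q (s≤s (s≤s (s≤s (s≤s (s≤s (s≤s (s≤s ())))))))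
      go (u ∷ u′ ∷ M) q _
        with s , s′ , s″ ← one-each q e e′ e″ u (∈-resp-↭ (↭-sym q) (∈-++⁺ʳ (a ∷ b ∷ a′ ∷ b′ ∷ a″ ∷ b″ ∷ []) (here refl)))
               (rest-isolated q e e′ e″ u (here refl))
        with c , d , f , uc , r ← orient u e s
           | c′ , d′ , f′ , uc′ , r′ ← orient u e′ s′
           | c″ , d″ , f″ , uc″ , r″ ← orient u e″ s″
        = oriented-absurd (↭-trans q (↭-trans r (prep c (prep d (↭-trans r′ (prep c′ (prep d′ r″)))))))
            f f′ f″ uc uc′ uc″

  -- Equivalently, L induces a disconnected subgraph of the complement of h.
  Join : List V → Set
  Join L = ∃₂ λ S K → L ↭ S ++ K × 0 < length S × 0 < length K × (∀ {s u} → s ∈ S → u ∈ K → h s u ≡ true)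

  -- The gain over `N-bound` is one factor `x − 1` in place of `x`. A vertex of degree at most 2
  -- gives it through the critical deletion, as `(x − 3) + 2 = x − 1`; a vertex of degree from 4 to
  -- `k` gives it through the noncritical one, as `(x − (k + 1)) + k = x − 1`. Degree 4 makes the
  -- deletion noncritical because `Mat-extend` would turn three pairs of `L′` into four pairs of
  -- `L`.
  N-bound-3 : ∀ k L x → 3 ≤ k → suc k ≤ x → length L ≡ suc k + 3 → ¬ Mat 4 L → ¬ Join L →
    N L x ≤ fall x (suc k) * (fall (x ∸ 1) 2 * (x ∸ 1))
  N-bound-3 k L x 3≤k k<x l ¬4 ¬j with search (λ v → deg v L ≤? 2) L
  ... | inj₁ (v , i , d) with L′ , p ← ∈⇒↭ i = ≤-trans
    (N-delete-critical (N-bound (k + 3)) k 2 x l ≤-refl 3≤k ¬4 p)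
    (*-monoʳ-≤ (fall x (suc k)) (*-monoʳ-≤ (fall (x ∸ 1) 2) (begin
      x ∸ 3 + deg v L′    ≤⟨ +-monoʳ-≤ (x ∸ 3) (subst (_≤ 2) (trans (deg-↭ v p) (deg-self v L′)) d) ⟩
      x ∸ 3 + 2           ≡⟨ cong (_+ 2) (∸-+-assoc x 1 2) ⟨
      x ∸ 1 ∸ 2 + 2       ≡⟨ m∸n+n≡m (≤-trans (≤-trans (s≤s (s≤s z≤n)) 3≤k) (∸-monoˡ-≤ 1 k<x)) ⟩
      x ∸ 1               ∎)))
    where open ≤-Reasoning
  ... | inj₂ δ with search (λ v → 4 ≤? deg v L) L
  ...   | inj₂ Δ = ⊥-elim contra
    where
    cub : ∀ v → v ∈ L → deg v L ≡ 3
    cub v i = ≤-antisym (≤-pred (≰⇒> (Δ v i))) (≰⇒> (δ v i))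
    -- All degrees equal 3: for `k = 3` there are seven vertices and parity decides, otherwise there
    -- are at least eight and four disjoint pairs appear.
    contra : ⊥
    contra with m≤n⇒m<n∨m≡n 3≤k
    ... | inj₂ refl = cubic-length≢7 L cub l
    ... | inj₁ 4≤k  = Cubic.cubic-absurd cub ¬4 (subst (8 ≤_) (sym l) (s≤s (+-monoˡ-≤ 3 4≤k)))
  ...   | inj₁ (v , i , D) with L′ , p ← ∈⇒↭ i = big-degree
    where
    D≡ : deg v L ≡ deg v L′
    D≡ = trans (deg-↭ v p) (deg-self v L′)
    big-degree : N L x ≤ fall x (suc k) * (fall (x ∸ 1) 2 * (x ∸ 1))
    big-degree with deg v L′ ≤? k
    ... | yes D≤k = ≤-trans
      (N-delete-noncritical (N-bound (k + 3)) k 2 x l ≤-refl (≤-trans (n≤1+n 2) 3≤k) ¬4 p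
        (λ m → ¬4 (Mat-↭ (↭-sym p) (Mat-extend m (subst (4 ≤_) D≡ D)))))
      (*-monoʳ-≤ (fall x (suc k)) (*-monoʳ-≤ (fall (x ∸ 1) 2) (begin
        x ∸ suc k + deg v L′  ≤⟨ +-monoʳ-≤ (x ∸ suc k) D≤k ⟩
        x ∸ suc k + k         ≡⟨ cong (_+ k) (∸-+-assoc x 1 k) ⟨
        x ∸ 1 ∸ k + k         ≡⟨ m∸n+n≡m (∸-monoˡ-≤ 1 k<x) ⟩
        x ∸ 1                 ∎)))
      where open ≤-Reasoning
    -- With more than `k` neighbours of `v` among `k + 3` entries, `v ∷ R` has at most three
    -- members. The entries of `K` are unrelated to each other and have degree at least 3, so each
    -- is related to all of `v ∷ R`, which is a join.
    ... | no D≰k with K , R , q , vK , lK ← neighbourhood v L′ =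
      ⊥-elim (¬j (v ∷ R , K , ↭-trans p (prep v (↭-trans q (++-comm K R))) , s≤s z≤n
                 , subst (0 <_) (sym lK) (≤-trans (s≤s z≤n) (≰⇒> D≰k)) , joined))
      where
      R≤2 : length (v ∷ R) ≤ 3
      R≤2 = +-cancelˡ-≤ k _ _ (begin
        k + suc (length R)     ≡⟨ +-suc k (length R) ⟩
        suc k + length R       ≤⟨ +-monoˡ-≤ (length R) (subst (suc k ≤_) (sym lK) (≰⇒> D≰k)) ⟩
        length K + length R    ≡⟨ length-++ K ⟨
        length (K ++ R)        ≡⟨ ↭-length q ⟨
        length L′              ≡⟨ suc-injective (trans (sym (↭-length p)) l) ⟩
        k + 3                  ∎)
        where open ≤-Reasoning
      isolated : ∀ {u} → u ∈ K → deg u K ≡ 0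
      isolated {u} i with 0 <? deg u K
      ... | no ¬d = n≤0⇒n≡0 (≮⇒≥ ¬d)
      ... | yes d with w , K′ , r , e ← neighbour u K d =
        ⊥-elim (tri (vK i) e (vK (∈-resp-↭ (↭-sym r) (here refl))))
      joined : ∀ {s u} → s ∈ v ∷ R → u ∈ K → h s u ≡ true
      joined {s} {u} i j = flip (deg-full u (v ∷ R) (≤-trans R≤2 (subst (3 ≤_) outside (≰⇒> (δ u u∈L)))) i)
        where
        u∈L : u ∈ L
        u∈L = ∈-resp-↭ (↭-sym p) (there (∈-resp-↭ (↭-sym q) (∈-++⁺ˡ j)))
        outside : deg u L ≡ deg u (v ∷ R)
        outside = trans (deg-↭ u p) (cong (⟦ h u v ⟧ +_) (trans (deg-↭ u q)
          (trans (deg-++ u K R) (cong (_+ deg u R) (isolated j)))))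

  -- Excess two and one: graphs covered by two stars or by one.

  common : V → V → List V → ℕ
  common a b = sumP (λ u _ → ⟦ h a u ⟧ * ⟦ h b u ⟧)

  -- Counts the ways of pairing `a` and `b` with two different entries, that is the two-pair
  -- matchings that join `a` and `b` to the list.
  cross : V → V → List V → ℕ
  cross a b = sumP (λ u K → ⟦ h a u ⟧ * deg b K)

  cross+common : ∀ a b K → cross a b K + common a b K ≡ deg a K * deg b K
  cross+common a b K = begin
    cross a b K + common a b K
      ≡⟨ sumP-+ _ _ K ⟨
    sumP (λ u K′ → ⟦ h a u ⟧ * deg b K′ + ⟦ h a u ⟧ * ⟦ h b u ⟧) K
      ≡⟨ sumP-cong K (λ u K′ _ → sym (*-distribˡ-+ ⟦ h a u ⟧ (deg b K′) ⟦ h b u ⟧)) ⟩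
    sumP (λ u K′ → ⟦ h a u ⟧ * (deg b K′ + ⟦ h b u ⟧)) K
      ≡⟨ sumP-deg a K (λ u K′ p _ → trans (+-comm (deg b K′) _) (sym (deg-↭ b p))) ⟩
    deg a K * deg b K ∎
    where open ≡-Reasoning

  inclusion-exclusion : ∀ a b K → deg a K + deg b K ≤ length K + common a b K
  inclusion-exclusion a b []      = z≤n
  inclusion-exclusion a b (u ∷ K) = begin
    (⟦ h a u ⟧ + deg a K) + (⟦ h b u ⟧ + deg b K)
      ≡⟨ shuffle ⟦ h a u ⟧ _ _ _ ⟩
    (⟦ h a u ⟧ + ⟦ h b u ⟧) + (deg a K + deg b K)
      ≤⟨ +-mono-≤ (bit (h a u) (h b u)) (inclusion-exclusion a b K) ⟩
    (1 + ⟦ h a u ⟧ * ⟦ h b u ⟧) + (length K + common a b K)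
      ≡⟨ shuffle 1 (⟦ h a u ⟧ * ⟦ h b u ⟧) (length K) (common a b K) ⟩
    (1 + length K) + (⟦ h a u ⟧ * ⟦ h b u ⟧ + common a b K) ∎
    where
    open ≤-Reasoning
    shuffle : ∀ p q r s → (p + q) + (r + s) ≡ (p + r) + (q + s)
    shuffle = solve-∀
    bit : ∀ p q → ⟦ p ⟧ + ⟦ q ⟧ ≤ 1 + ⟦ p ⟧ * ⟦ q ⟧
    bit true  true  = ≤-refl
    bit true  false = ≤-refl
    bit false true  = ≤-refl
    bit false false = z≤n

  -- The factor left after `(x)ⱼ` for an independent list of `j` entries, with `z = x − j` free
  -- colours, `p` and `q` the degrees of the two centres, `e` telling whether they are related, and
  -- `t` the value of `cross`. The summands stand for: first centre alone, centres paired together,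
  -- first centre joined to the list with the second alone, both joined.
  doubleStar : (z p q e t : ℕ) → ℕ
  doubleStar z p q e t = z * ((z ∸ 1) + q) + (e * z + (p * z + t))

  N-double-star : ∀ a b K x m → ¬ Mat 1 K → length K ≡ suc m →
    N (a ∷ b ∷ K) x ≡ fall x (suc m) * doubleStar (x ∸ suc m) (deg a K) (deg b K) ⟦ h a b ⟧ (cross a b K)
  N-double-star a b K x m ¬m l = begin
    N (a ∷ b ∷ K) x
      ≡⟨ N-cons a (b ∷ K) x ⟩
    x * (N (b ∷ K) (x ∸ 1) + (⟦ h a b ⟧ * N K (x ∸ 1) + sumP (λ u L → ⟦ h a u ⟧ * N (b ∷ L) (x ∸ 1)) K))
      ≡⟨ cong (x *_) (cong₂ _+_ first (cong₂ _+_ (cong (⟦ h a b ⟧ *_) second) third)) ⟩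
    x * (f * z * ((z ∸ 1) + q) + (⟦ h a b ⟧ * (f * z) + f * (p * z + cross a b K)))
      ≡⟨ factor x f z (z ∸ 1 + q) ⟦ h a b ⟧ (p * z + cross a b K) ⟩
    x * f * doubleStar z p q ⟦ h a b ⟧ (cross a b K) ∎
    where
    open ≡-Reasoning
    f = fall (x ∸ 1) m
    z = x ∸ suc m
    p = deg a K
    q = deg b K
    factor : ∀ x f z r e s → x * (f * z * r + (e * (f * z) + f * s)) ≡ x * f * (z * r + (e * z + s))
    factor = solve-∀
    last : fall (x ∸ 1) (suc m) ≡ f * z
    last = trans (fall-last (x ∸ 1) m) (cong (f *_) (∸-+-assoc x 1 m))
    first : N (b ∷ K) (x ∸ 1) ≡ f * z * ((z ∸ 1) + q)
    first = trans (N-star b K (x ∸ 1) ¬m) (trans (cong (λ j → fall (x ∸ 1) j * ((x ∸ 1 ∸ j) + q)) l)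
      (cong₂ (λ s t → s * (t + q)) last
        (trans (∸-+-assoc x 1 (suc m)) (trans (cong (x ∸_) (+-comm 1 (suc m))) (sym (∸-+-assoc x (suc m) 1))))))
    second : N K (x ∸ 1) ≡ f * z
    second = trans (N-indep K (x ∸ 1) ¬m) (trans (cong (fall (x ∸ 1)) l) last)
    rearrange : ∀ e f z d → e * (f * (z + d)) ≡ f * (e * z + e * d)
    rearrange = solve-∀
    third : sumP (λ u L → ⟦ h a u ⟧ * N (b ∷ L) (x ∸ 1)) K ≡ f * (p * z + cross a b K)
    third = begin
      sumP (λ u L → ⟦ h a u ⟧ * N (b ∷ L) (x ∸ 1)) K
        ≡⟨ sumP-cong K (λ u L r → trans (cong (⟦ h a u ⟧ *_) (trans
             (N-star b L (x ∸ 1) (λ m → ¬m (Mat-↭ (↭-sym r) (Mat-weaken m))))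
             (trans (cong (λ j → fall (x ∸ 1) j * ((x ∸ 1 ∸ j) + deg b L)) (suc-injective (trans (sym (↭-length r)) l)))
               (cong (λ s → f * (s + deg b L)) (∸-+-assoc x 1 m)))))
             (rearrange ⟦ h a u ⟧ f z (deg b L))) ⟩
      sumP (λ u L → f * (⟦ h a u ⟧ * z + ⟦ h a u ⟧ * deg b L)) K
        ≡⟨ sumP-* f _ K ⟩
      f * sumP (λ u L → ⟦ h a u ⟧ * z + ⟦ h a u ⟧ * deg b L) K
        ≡⟨ cong (f *_) (trans (sumP-+ _ _ K) (cong (_+ cross a b K) (sumP-deg a K λ _ _ _ _ → refl))) ⟩
      f * (p * z + cross a b K) ∎

  -- The product chooses for each centre, independently, a free colour or a neighbour to join. The
  -- clashes are `z` equal free colours and `c` equal neighbours; if the centres are related, equal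
  -- free colours are allowed again.
  doubleStar-complete : ∀ z {p q t c} e → t + c ≡ p * q →
    doubleStar z p q e t + (z + c) ≡ (z + p) * (z + q) + e * z
  doubleStar-complete z {p} {q} {t} {c} e tc = begin
    doubleStar z p q e t + (z + c)               ≡⟨ r₁ z (z ∸ 1) p q e t c ⟩
    (z * (z ∸ 1) + z) + (q * z + p * z + (t + c)) + e * z ≡⟨ cong₂ (λ a b → a + (q * z + p * z + b) + e * z) (sq z) tc ⟩
    z * z + (q * z + p * z + p * q) + e * z      ≡⟨ r₂ z p q e ⟩
    (z + p) * (z + q) + e * z                    ∎
    where
    open ≡-Reasoning
    sq : ∀ z → z * (z ∸ 1) + z ≡ z * z
    sq zero    = refl
    sq (suc z) = trans (+-comm _ (suc z)) (sym (*-suc (suc z) z))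
    r₁ : ∀ z y p q e t c → (z * (y + q) + (e * z + (p * z + t))) + (z + c)
                         ≡ (z * y + z) + (q * z + p * z + (t + c)) + e * z
    r₁ = solve-∀
    r₂ : ∀ z p q e → z * z + (q * z + p * z + p * q) + e * z ≡ (z + p) * (z + q) + e * z
    r₂ = solve-∀

  -- Put `n = z + m`, `P = z + p`, `Q = z + q`. For unrelated centres the value is `PQ − (z + c)`,
  -- and `p + q ≤ m + 2 + c` turns this into at most `(P − 1)(Q − 1) + n + 1`. As `P` and `Q` are at
  -- most `n + 1`, the maximum `n² + n + 1` needs `P = Q = n + 1`, and then `z + c = n`. Related
  -- centres have degrees at most `m` in the list, which keeps the value below.
  doubleStar-extremal : ∀ m z {p q b t c} → 2 ≤ m → t + c ≡ p * q → p + q ≤ suc (suc m) + c →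
    ⟦ b ⟧ + p ≤ suc m → ⟦ b ⟧ + q ≤ suc m →
    doubleStar z p q ⟦ b ⟧ t < suc ((z + m) * suc (z + m)) ⊎
    (doubleStar z p q ⟦ b ⟧ t ≡ suc ((z + m) * suc (z + m)) × b ≡ false × p ≡ suc m × q ≡ suc m × c ≡ m)
  doubleStar-extremal m z {p} {q} {b} {t} {c} 2≤m tc pq bp bq = go b bp bq
    where
    complete : ∀ e → doubleStar z p q e t + (z + c) ≡ (z + p) * (z + q) + e * z
    complete e = doubleStar-complete z e tc
    n = z + m
    go : ∀ b → ⟦ b ⟧ + p ≤ suc m → ⟦ b ⟧ + q ≤ suc m →
      doubleStar z p q ⟦ b ⟧ t < suc (n * suc n) ⊎
      (doubleStar z p q ⟦ b ⟧ t ≡ suc (n * suc n) × b ≡ false × p ≡ suc m × q ≡ suc m × c ≡ m)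
    go true (s≤s bp) (s≤s bq) = inj₁ (s≤s (≤-trans (m≤m+n _ c) (begin
      doubleStar z p q 1 t + c  ≤⟨ ≤-reflexive (+-cancelʳ-≡ z _ _ (trans (trans (+-assoc _ c z)
                                     (cong (doubleStar z p q 1 t +_) (+-comm c z))) (trans (complete 1) (cong ((z + p) * (z + q) +_) (+-identityʳ z))))) ⟩
      (z + p) * (z + q)         ≤⟨ *-mono-≤ (+-monoʳ-≤ z bp) (≤-trans (+-monoʳ-≤ z bq) (n≤1+n n)) ⟩
      n * suc n                 ∎)))
      where open ≤-Reasoning
    go false bp bq = core (z + p) (z + q) (subst (z + p ≤_) (+-suc z m) (+-monoʳ-≤ z bp)) (subst (z + q ≤_) (+-suc z m) (+-monoʳ-≤ z bq)) refl refl
        (trans (complete 0) (+-identityʳ _))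
        (subst₂ _≤_ (r₃ z p q) (r₄ z m c) (+-monoʳ-≤ (z + z) pq))
      where
      D = doubleStar z p q 0 t
      r₃ : ∀ z p q → z + z + (p + q) ≡ (z + p) + (z + q)
      r₃ = solve-∀
      r₄ : ∀ z m c → z + z + (suc (suc m) + c) ≡ suc (suc (z + m)) + (z + c)
      r₄ = solve-∀
      core : ∀ P Q → P ≤ suc n → Q ≤ suc n → P ≡ z + p → Q ≡ z + q → D + (z + c) ≡ P * Q →
        P + Q ≤ suc (suc n) + (z + c) →
        D < suc (n * suc n) ⊎ (D ≡ suc (n * suc n) × false ≡ false × p ≡ suc m × q ≡ suc m × c ≡ m)
      core zero    Q       _ _ _ _ eq _ = inj₁ (≤-trans (s≤s (≤-trans (m≤m+n D (z + c)) (≤-reflexive eq))) (s≤s z≤n))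
      core (suc P) zero    _ _ _ _ eq _ = inj₁ (≤-trans (s≤s (≤-trans (m≤m+n D (z + c)) (≤-reflexive (trans eq (*-zeroʳ P))))) (s≤s z≤n))
      core (suc P) (suc Q) (s≤s P≤n) (s≤s Q≤n) eP eQ eq le = outcome
        where
        D≤ : D ≤ suc (P * Q + n)
        D≤ = +-cancelʳ-≤ (suc (P + Q)) _ _ (begin
          D + suc (P + Q)                   ≤⟨ +-monoʳ-≤ D (≤-pred (subst (_≤ suc (suc n) + (z + c)) (cong suc (+-suc P Q)) le)) ⟩
          D + (suc n + (z + c))             ≡⟨ r₅ D n (z + c) ⟩
          D + (z + c) + suc n               ≡⟨ cong (_+ suc n) eq ⟩
          suc P * suc Q + suc n             ≡⟨ r₆ P Q n ⟩
          suc (P * Q + n) + suc (P + Q)     ∎)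
          where
          open ≤-Reasoning
          r₅ : ∀ d n s → d + (suc n + s) ≡ d + s + suc n
          r₅ = solve-∀
          r₆ : ∀ p q n → suc p * suc q + suc n ≡ suc (p * q + n) + suc (p + q)
          r₆ = solve-∀
        n>0 : 0 < n
        n>0 = ≤-trans (≤-trans (s≤s z≤n) 2≤m) (m≤n+m m z)
        target : n * n + n ≡ n * suc n
        target = trans (+-comm (n * n) n) (sym (*-suc n n))
        small : P * Q < n * n → D < suc (n * suc n)
        small l = s≤s (≤-trans D≤ (≤-trans (+-monoˡ-≤ n l) (≤-reflexive target)))
        unshift : ∀ {w r} → w ≡ n → suc w ≡ z + r → r ≡ suc m
        unshift {w} {r} e e′ = +-cancelˡ-≡ z _ _ (trans (sym e′) (trans (cong suc e) (sym (+-suc z m))))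
        outcome : D < suc (n * suc n) ⊎ (D ≡ suc (n * suc n) × false ≡ false × p ≡ suc m × q ≡ suc m × c ≡ m)
        outcome with m≤n⇒m<n∨m≡n P≤n | m≤n⇒m<n∨m≡n Q≤n
        ... | inj₁ P<n | _        = inj₁ (small (≤-trans (s≤s (*-monoʳ-≤ P Q≤n)) (*-monoˡ-< n {{>-nonZero n>0}} P<n)))
        ... | inj₂ _   | inj₁ Q<n = inj₁ (small (≤-trans (s≤s (*-monoˡ-≤ Q P≤n)) (*-monoʳ-< n {{>-nonZero n>0}} Q<n)))
        ... | inj₂ P≡n | inj₂ Q≡n with m≤n⇒m<n∨m≡n D≤W
          where
          D≤W : D ≤ suc (n * suc n)
          D≤W = ≤-trans D≤ (s≤s (≤-trans (+-monoˡ-≤ n (*-mono-≤ P≤n Q≤n)) (≤-reflexive target)))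
        ...   | inj₁ lt  = inj₁ lt
        ...   | inj₂ D≡W = inj₂ (D≡W , refl , unshift P≡n eP , unshift Q≡n eQ , +-cancelˡ-≡ z _ _ s≡n)
          where
          r₇ : ∀ n → suc n * suc n ≡ suc (n * suc n) + n
          r₇ = solve-∀
          s≡n : z + c ≡ z + m
          s≡n = +-cancelˡ-≡ (suc (n * suc n)) _ _ (trans (cong (_+ (z + c)) (sym D≡W))
            (trans eq (trans (cong₂ (λ a b → suc a * suc b) P≡n Q≡n) (r₇ n))))

  N-star-≤ : ∀ M x j → length M ≡ suc j → ¬ Mat 2 M → (∀ v → v ∈ M → deg v M ≤ 2) →
    N M x ≤ fall x j * ((x ∸ j) + 2)
  N-star-≤ M x j l ¬2 Δ with c , K , p , ¬1 ← star M (subst (0 <_) (sym l) (s≤s z≤n)) ¬2 = begin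
    N M x                                          ≡⟨ trans (N-↭ h-sym x p) (N-star c K x ¬1) ⟩
    fall x (length K) * ((x ∸ length K) + deg c K) ≡⟨ cong (λ i → fall x i * ((x ∸ i) + deg c K)) (suc-injective (trans (sym (↭-length p)) l)) ⟩
    fall x j * ((x ∸ j) + deg c K)                 ≤⟨ *-monoʳ-≤ (fall x j) (+-monoʳ-≤ (x ∸ j)
                                                       (subst (_≤ 2) (trans (deg-↭ c p) (deg-self c K)) (Δ c (∈-resp-↭ (↭-sym p) (here refl))))) ⟩
    fall x j * ((x ∸ j) + 2)                       ∎
    where open ≤-Reasoning

  -- Both ends of one pair `a`-`b` are expanded. In each branch the remaining list, together with a
  -- pair at `a`, would give three pairs if it contained two, so it is a star with at most two
  -- leaves. There are at most two partners for `a`, and at most one for `b` besides `a`.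
  N-bound-2-sparse : ∀ L m z → length L ≡ suc (suc m) + 2 → ¬ Mat 3 L → (∀ v → v ∈ L → deg v L ≤ 2) → Mat 1 L →
    N L (suc (suc (z + m))) ≤ fall (suc (suc (z + m))) (suc (suc m)) * (z * suc z + (z + 2) + 2 * (z + 2))
  N-bound-2-sparse L m z l ¬3 Δ (pair {u = a} {b} {L′} p e _) = begin
    N L x
      ≤⟨ N-delete x p
           (N-delete (suc (z + m)) ↭-refl
             (≤-trans (N-star-≤ L′ (z + m) (suc m) l′ (λ m → ¬3 (pair p e m)) (λ v i → Δ′ (sub-refl i)))
               (≤-reflexive (cong₂ (λ s t → s * (t + 2)) (trans (fall-last (z + m) m) (cong (f *_) (m+n∸n≡m z m))) z-1)))
             (λ u L″ q _ → ≤-trans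
               (N-star-≤ L″ (z + m) m (suc-injective (trans (sym (↭-length q)) l′))
                 (λ m → ¬3 (pair p e (Mat-↭ (↭-sym q) (Mat-weaken m))))
                 (λ v i → ≤-trans (deg-tail q) (Δ′ (sub-refl (∈-resp-↭ (↭-sym q) (there i))))))
               (≤-reflexive (cong (λ t → f * (t + 2)) (m+n∸n≡m z m)))))
           (λ u L″ q h₁ → ≤-trans
             (N-star-≤ L″ (suc (z + m)) (suc m) (suc-injective (trans (sym (↭-length q)) (cong suc l′)))
               (λ m → ¬3 (pair (↭-trans p (prep a q)) h₁ m))
               (λ v i → ≤-trans (deg-tail q) (≤-trans (deg-tail p) (Δ v (∈-resp-↭ (↭-sym p) (there (∈-resp-↭ (↭-sym q) (there i))))))))
             (≤-reflexive (cong (λ t → suc (z + m) * f * (t + 2)) (m+n∸n≡m z m)))) ⟩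
    x * (suc (z + m) * (f * z * ((z ∸ 1) + 2) + deg b L′ * (f * (z + 2))) + deg a (b ∷ L′) * (suc (z + m) * f * (z + 2)))
      ≤⟨ *-monoʳ-≤ x (+-mono-≤ (*-monoʳ-≤ (suc (z + m)) (+-mono-≤ (drop z) (*-monoˡ-≤ (f * (z + 2)) db)))
           (*-monoˡ-≤ (suc (z + m) * f * (z + 2)) da)) ⟩
    x * (suc (z + m) * (f * (z * suc z) + 1 * (f * (z + 2))) + 2 * (suc (z + m) * f * (z + 2)))
      ≡⟨ collect x (suc (z + m)) f (z * suc z) (z + 2) ⟩
    fall x (suc (suc m)) * (z * suc z + (z + 2) + 2 * (z + 2)) ∎
    where
    open ≤-Reasoning
    x = suc (suc (z + m))
    f = fall (z + m) m
    l′ : length L′ ≡ suc (suc m)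
    l′ = suc-injective (suc-injective (trans (sym (↭-length p)) (trans l (+-comm (suc (suc m)) 2))))
    z-1 : z + m ∸ suc m ≡ z ∸ 1
    z-1 = trans (cong (z + m ∸_) (+-comm 1 m)) (trans (sym (∸-+-assoc (z + m) m 1)) (cong (_∸ 1) (m+n∸n≡m z m)))
    deg-tail : ∀ {v u} {M M′ : List V} → M ↭ u ∷ M′ → deg v M′ ≤ deg v M
    deg-tail {v} {u} {M} {M′} q = subst (deg v M′ ≤_) (sym (deg-↭ v q)) (m≤n+m (deg v M′) ⟦ h v u ⟧)
    sub-refl : ∀ {v} → v ∈ L′ → v ∈ L
    sub-refl i = ∈-resp-↭ (↭-sym p) (there (there i))
    Δ′ : ∀ {v} → v ∈ L → deg v L′ ≤ 2
    Δ′ {v} i = ≤-trans (deg-tail {v} {b} {b ∷ L′} {L′} ↭-refl) (≤-trans (deg-tail p) (Δ v i))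
    da : deg a (b ∷ L′) ≤ 2
    da = ≤-trans (deg-tail p) (Δ a (∈-resp-↭ (↭-sym p) (here refl)))
    db : deg b L′ ≤ 1
    db = ≤-pred (subst (_≤ 2) (trans (deg-↭ b p) (cong₂ (λ s t → ⟦ s ⟧ + (⟦ t ⟧ + deg b L′)) (flip e) (h-irrefl b)))
      (Δ b (∈-resp-↭ (↭-sym p) (there (here refl)))))
    -- `(z ∸ 1) + 2` is `suc z` except for `z = 0`, where the factor `z` vanishes.
    drop : ∀ z → f * z * ((z ∸ 1) + 2) ≤ f * (z * suc z)
    drop zero    = ≤-reflexive (trans (cong (_* 2) (*-zeroʳ f)) (sym (*-zeroʳ f)))
    drop (suc z) = ≤-reflexive (trans (*-assoc f (suc z) (z + 2)) (cong (λ s → f * (suc z * s)) (+-comm z 2)))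
    collect : ∀ x y f r s → x * (y * (f * r + 1 * (f * s)) + 2 * (y * f * s)) ≡ x * (y * f) * (r + s + 2 * s)
    collect = solve-∀

  -- Used with `K` of length `m + 2`: each centre misses exactly one entry of `K`, and
  -- `common a b K ≡ m` says that the two missed entries differ. This is the complement of
  -- `G_{k+2,k}`, with the path vertices as centres.
  Extremal₂ : ℕ → List V → Set
  Extremal₂ m L = ∃₂ λ a b → ∃ λ K → L ↭ a ∷ b ∷ K × ¬ Mat 1 K × h a b ≡ false ×
    deg a K ≡ suc m × deg b K ≡ suc m × common a b K ≡ m

  -- A vertex of degree at least 3 extends any two pairs of the rest, so the rest is a star and two
  -- centres cover everything. Without such a vertex the sparse estimate applies, unless there are
  -- no pairs at all, when any two vertices serve as centres. Throughout, `m = k − 2` and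
  -- `z = x − k`.
  N-bound-2 : ∀ L m z → 2 ≤ m → length L ≡ suc (suc m) + 2 → ¬ Mat 3 L → (∀ v → v ∈ L → deg v L ≤ suc m) →
    let x = suc (suc (z + m)); B = fall x (suc (suc m)) * suc ((z + m) * suc (z + m)) in
    N L x < B ⊎ (N L x ≡ B × Extremal₂ m L)
  N-bound-2 L m z 2≤m l ¬3 Δ = decide
    where
    x = suc (suc (z + m))
    φ = fall x (suc (suc m))
    φ>0 : 0 < φ
    φ>0 = fall-pos (s≤s (s≤s (m≤n+m m z)))
    instance
      φ≢0 : NonZero φ
      φ≢0 = >-nonZero φ>0
    Goal : Set
    Goal = N L x < φ * suc ((z + m) * suc (z + m)) ⊎ (N L x ≡ φ * suc ((z + m) * suc (z + m)) × Extremal₂ m L)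
    rest-length : ∀ {a b K} → L ↭ a ∷ b ∷ K → length K ≡ suc (suc m)
    rest-length p = suc-injective (suc-injective (trans (sym (↭-length p)) (trans l (+-comm (suc (suc m)) 2))))
    formula : ∀ a b K → L ↭ a ∷ b ∷ K → ¬ Mat 1 K → N L x ≡ φ * doubleStar z (deg a K) (deg b K) ⟦ h a b ⟧ (cross a b K)
    formula a b K p ¬1 = trans (N-↭ h-sym x p) (trans (N-double-star a b K x (suc m) ¬1 (rest-length p))
      (cong (λ i → φ * doubleStar i (deg a K) (deg b K) ⟦ h a b ⟧ (cross a b K)) (m+n∸n≡m z m)))
    covered : ∀ a b K → L ↭ a ∷ b ∷ K → ¬ Mat 1 K → Goal
    covered a b K p ¬1 with doubleStar-extremal m z {deg a K} {deg b K} {h a b} {cross a b K} {common a b K} 2≤m (cross+common a b K)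
        (subst (λ i → deg a K + deg b K ≤ i + common a b K) (rest-length p) (inclusion-exclusion a b K))
        (subst (_≤ suc m) (trans (deg-↭ a p) (deg-self a (b ∷ K))) (Δ a (∈-resp-↭ (↭-sym p) (here refl))))
        (subst (_≤ suc m) (trans (deg-↭ b p) (cong₂ (λ s t → ⟦ s ⟧ + (⟦ t ⟧ + deg b K)) (h-sym b a) (h-irrefl b)))
          (Δ b (∈-resp-↭ (↭-sym p) (there (here refl)))))
    ... | inj₁ lt = inj₁ (subst (_< _) (sym (formula a b K p ¬1)) (*-monoʳ-< φ lt))
    ... | inj₂ (eq , ab , da , db , c) =
      inj₂ (trans (formula a b K p ¬1) (cong (φ *_) eq) , a , b , K , p , ¬1 , ab , da , db , c)
    -- The left side is `(z + 2)(z + 3) − z`; here `2 ≤ m`, that is `k ≥ 4`, makes it smaller.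
    sparse : z * suc z + (z + 2) + 2 * (z + 2) < suc ((z + m) * suc (z + m))
    sparse = s≤s (begin
      z * suc z + (z + 2) + 2 * (z + 2)       ≤⟨ m≤m+n _ z ⟩
      z * suc z + (z + 2) + 2 * (z + 2) + z   ≡⟨ square z ⟩
      (z + 2) * suc (z + 2)                   ≤⟨ *-mono-≤ (+-monoʳ-≤ z 2≤m) (s≤s (+-monoʳ-≤ z 2≤m)) ⟩
      (z + m) * suc (z + m)                   ∎)
      where
      open ≤-Reasoning
      square : ∀ z → z * suc z + (z + 2) + 2 * (z + 2) + z ≡ (z + 2) * suc (z + 2)
      square = solve-∀
    edgeless : ∀ M → length M ≡ suc (suc m) + 2 → L ↭ M → ¬ Mat 1 L → Goal
    edgeless (a ∷ [])    lM p ¬1 = case suc-injective lM of λ ()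
    edgeless (a ∷ b ∷ K) lM p ¬1 = covered a b K p λ e → ¬1 (Mat-↭ (↭-sym p) (Mat-weaken (Mat-weaken e)))
    decide : Goal
    decide with search (λ v → 3 ≤? deg v L) L
    ... | inj₁ (a , i , D) with L′ , p ← ∈⇒↭ i
      with b , K , q , ¬1 ← star L′ (subst (0 <_) (suc-injective (trans (sym l) (↭-length p))) (s≤s z≤n))
             (λ e → ¬3 (Mat-↭ (↭-sym p) (Mat-extend e (subst (3 ≤_) (trans (deg-↭ a p) (deg-self a L′)) D))))
      = covered a b K (↭-trans p (prep a q)) ¬1
    decide | inj₂ Δ₂ with search (λ v → 0 <? deg v L) L
    ... | inj₂ iso = edgeless L l ↭-refl (isolated⇒indep L iso)
    ... | inj₁ (v , i , d) = inj₁ (≤-trans (s≤s (N-bound-2-sparse L m z l ¬3 (λ v i → ≤-pred (≰⇒> (Δ₂ v i))) (Mat-1 i d)))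
      (*-monoʳ-< φ sparse))

  -- Used with `K` of length `m + 2`: in the complementary graph `c` is joined to exactly two
  -- vertices of the clique `K`, as in `G_{k+1,k}`.
  Extremal₁ : ℕ → List V → Set
  Extremal₁ m L = ∃₂ λ c K → L ↭ c ∷ K × ¬ Mat 1 K × deg c K ≡ m

  N-star-length : ∀ {L c K} m z → length L ≡ suc (suc m) + 1 → L ↭ c ∷ K → ¬ Mat 1 K →
    N L (suc (suc (z + m))) ≡ fall (suc (suc (z + m))) (suc (suc m)) * (z + deg c K)
  N-star-length {L} {c} {K} m z l p ¬1 = trans (N-↭ h-sym x p) (trans (N-star c K x ¬1) (trans
    (cong (λ i → fall x i * ((x ∸ i) + deg c K))
      (suc-injective (trans (sym (↭-length p)) (trans l (+-comm (suc (suc m)) 1)))))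
    (cong (λ i → fall x (suc (suc m)) * (i + deg c K)) (m+n∸n≡m z m))))
    where x = suc (suc (z + m))

  -- The count is strictly increasing in the degree of the centre of the star, so it is largest
  -- exactly when this degree is `m`.
  N-bound-1 : ∀ L m z → length L ≡ suc (suc m) + 1 → ¬ Mat 2 L → (∀ v → v ∈ L → deg v L ≤ m) →
    let x = suc (suc (z + m)); B = fall x (suc (suc m)) * (z + m) in
    N L x < B ⊎ (N L x ≡ B × Extremal₁ m L)
  N-bound-1 L m z l ¬2 Δ with c , K , p , ¬1 ← star L (subst (0 <_) (sym l) (s≤s z≤n)) ¬2
    with m≤n⇒m<n∨m≡n (subst (_≤ m) (trans (deg-↭ c p) (deg-self c K)) (Δ c (∈-resp-↭ (↭-sym p) (here refl))))
  ... | inj₁ lt = inj₁ (subst (_< φ * (z + m)) (sym (N-star-length m z l p ¬1)) (*-monoʳ-< φ (+-monoʳ-< z lt)))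
    where
    φ = fall (suc (suc (z + m))) (suc (suc m))
    instance
      φ≢0 : NonZero φ
      φ≢0 = >-nonZero (fall-pos (s≤s (s≤s (m≤n+m m z))))
  ... | inj₂ eq = inj₂ (trans (N-star-length m z l p ¬1)
    (cong (λ i → fall (suc (suc (z + m))) (suc (suc m)) * (z + i)) eq) , c , K , p , ¬1 , eq)

-- List colourings and their splitting by one colour.

Unique-resp-↭ : {V : Set} {L L′ : List V} → L ↭ L′ → Unique L → Unique L′
Unique-resp-↭ Perm.refl        uq                            = uq
Unique-resp-↭ (prep u p)       (u∉ ∷ uq)                     = All-resp-↭ p u∉ ∷ Unique-resp-↭ p uq
Unique-resp-↭ (swap u v p)     ((u≢v ∷ u∉) ∷ (v∉ ∷ uq))      =
  (≢-sym u≢v ∷ All-resp-↭ p v∉) ∷ (All-resp-↭ p u∉ ∷ Unique-resp-↭ p uq)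
Unique-resp-↭ (Perm.trans p q) uq                            = Unique-resp-↭ q (Unique-resp-↭ p uq)

∑-allFin-suc : ∀ x (f : Fin (suc x) → ℕ) → ∑ (allFin (suc x)) f ≡ f zero + ∑ (allFin x) (f ∘ suc)
∑-allFin-suc x f = cong (f zero +_) (go x _)
  where
  go : ∀ m (g : Fin m → Fin x) → ∑ (tabulate (suc ∘ g)) f ≡ ∑ (tabulate g) (f ∘ suc)
  go zero    g = refl
  go (suc m) g = cong (f (suc (g zero)) +_) (go m (g ∘ suc))

_==_ : ∀ {x} → Fin x → Fin x → Bool
a == c = does (a Fin.≟ c)

∑-indicator : ∀ {x} (a : Fin x) → ∑ (allFin x) (λ c → ⟦ a == c ⟧) ≡ 1
∑-indicator {suc x} zero    = trans (∑-allFin-suc x (λ c → ⟦ zero == c ⟧)) (cong suc (∑-zero (allFin x)))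
∑-indicator {suc x} (suc a) = trans (∑-allFin-suc x (λ c → ⟦ suc a == c ⟧)) (∑-indicator a)

module ListColouring {n} (G : Graph n) (x : ℕ) where

  Lists : Set
  Lists = Fin n → Fin x → Bool

  restrict : Lists → Fin n → Fin x → Lists
  restrict A v a u c = A u c ∧ not (adj G v u ∧ (a == c))

  delete : Lists → Fin x → Lists
  delete A a u c = A u c ∧ not (a == c)

  -- The number of proper colourings with prescribed lists. Lists are needed because colouring a
  -- vertex forbids its colour only at its neighbours, until `col-split` settles which other vertex
  -- receives it.
  col : List (Fin n) → Lists → ℕ
  col []      A = 1
  col (v ∷ L) A = ∑ (allFin x) λ c → ⟦ A v c ⟧ * col L (restrict A v c)

  col-cong : ∀ L {A B} → (∀ u → u ∈ L → ∀ c → A u c ≡ B u c) → col L A ≡ col L B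
  col-cong []      e = refl
  col-cong (v ∷ L) e = ∑-cong (allFin x) λ c → cong₂ (λ b s → ⟦ b ⟧ * s) (e v (here refl) c)
    (col-cong L λ u i c′ → cong (_∧ _) (e u (there i) c′))

  -- If the vertices that may receive the colour a form a clique, then at most one of them does.
  col-split : ∀ L A a → AllPairs (λ u w → A u a ≡ true → A w a ≡ true → Adj G u w) L →
    col L A ≡ col L (delete A a) + sumP (λ u L′ → ⟦ A u a ⟧ * col L′ (delete A a)) L
  col-split []      A a cl = refl
  col-split (w ∷ L) A a (clw ∷ cl) = begin
    ∑ cs (λ c → ⟦ A w c ⟧ * col L (restrict A w c))
      ≡⟨ ∑-cong cs split ⟩
    ∑ cs (λ c → ⟦ A′ w c ⟧ * (col L (restrict A′ w c) + S c) + ⟦ a == c ⟧ * K)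
      ≡⟨ ∑-+ cs _ _ ⟩
    ∑ cs (λ c → ⟦ A′ w c ⟧ * (col L (restrict A′ w c) + S c)) + ∑ cs (λ c → ⟦ a == c ⟧ * K)
      ≡⟨ cong₂ _+_ (trans (∑-cong cs λ c → *-distribˡ-+ ⟦ A′ w c ⟧ _ (S c)) (∑-+ cs _ _))
           (trans (∑-*ʳ cs _ K) (trans (cong (_* K) (∑-indicator a)) (+-identityʳ K))) ⟩
    col (w ∷ L) A′ + ∑ cs (λ c → ⟦ A′ w c ⟧ * S c) + K
      ≡⟨ cong (λ s → col (w ∷ L) A′ + s + K) collect ⟩
    col (w ∷ L) A′ + T + K
      ≡⟨ trans (+-assoc (col (w ∷ L) A′) T K) (cong (col (w ∷ L) A′ +_) (+-comm T K)) ⟩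
    col (w ∷ L) A′ + (K + T) ∎
    where
    open ≡-Reasoning
    cs = allFin x
    A′ = delete A a
    K  = ⟦ A w a ⟧ * col L A′
    S : Fin x → ℕ
    S c = sumP (λ u L′ → ⟦ A u a ⟧ * col L′ (restrict A′ w c)) L
    T = sumP (λ u L′ → ⟦ A u a ⟧ * col (w ∷ L′) A′) L
    *-rotate : ∀ p q r → p * (q * r) ≡ q * (p * r)
    *-rotate = solve-∀
    collect : ∑ cs (λ c → ⟦ A′ w c ⟧ * S c) ≡ T
    collect = trans (∑-cong cs λ c → sym (sumP-* ⟦ A′ w c ⟧ _ L))
      (trans (∑-sumP cs _ L) (sumP-cong L λ u L′ _ → trans
        (∑-cong cs λ c → *-rotate ⟦ A′ w c ⟧ ⟦ A u a ⟧ _) (∑-*ˡ cs _ ⟦ A u a ⟧)))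
    ∧-exchange : ∀ p q r → (p ∧ q) ∧ r ≡ (p ∧ r) ∧ q
    ∧-exchange false _     _     = refl
    ∧-exchange true  true  true  = refl
    ∧-exchange true  true  false = refl
    ∧-exchange true  false true  = refl
    ∧-exchange true  false false = refl
    split : ∀ c → ⟦ A w c ⟧ * col L (restrict A w c)
              ≡ ⟦ A′ w c ⟧ * (col L (restrict A′ w c) + S c) + ⟦ a == c ⟧ * K
    split c with a Fin.≟ c
    split .a | yes refl with A w a in eq
    ... | false = refl
    -- Every other vertex that may receive `a` is adjacent to `w`, so removing `a` at the neighbours
    -- of `w` removes it everywhere.
    ... | true  = sym (trans (+-identityʳ _) (trans (+-identityʳ _) (trans (sym (+-identityʳ _)) (cong (_+ 0)
      (col-cong L λ u i c → sym (agree u c (All.lookup clw i refl)))))))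
      where
      agree : ∀ u c → (A u a ≡ true → Adj G w u) → A u c ∧ not (adj G w u ∧ (a == c)) ≡ A u c ∧ not (a == c)
      agree u c adj! with a Fin.≟ c
      ... | no _     = cong (λ b → A u c ∧ not b) (Bool.∧-zeroʳ _)
      ... | yes refl with A u a in e
      ...   | false = refl
      ...   | true  = cong (λ b → not (b ∧ true)) (adj! refl)
    -- A colour other than `a` on `w` does not change which vertices may receive `a`, so the clique
    -- hypothesis survives.
    split c | no a≢c = trans (cong₂ (λ b s → ⟦ b ⟧ * s) (sym (Bool.∧-identityʳ (A w c))) (trans
        (col-split L (restrict A w c) a (AP-map cl))
        (cong₂ _+_ (col-cong L λ u _ c′ → ∧-exchange (A u c′) _ _)
          (sumP-cong L λ u L′ _ → cong₂ (λ b s → ⟦ b ⟧ * s) (same u)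
            (col-cong L′ λ u _ c′ → ∧-exchange (A u c′) _ _)))))
      (sym (+-identityʳ _))
      where
      same : ∀ u → restrict A w c u a ≡ A u a
      same u = trans (cong (λ b → A u a ∧ not (adj G w u ∧ b)) (dec-false (c Fin.≟ a) (a≢c ∘ sym)))
        (trans (cong (λ b → A u a ∧ not b) (Bool.∧-zeroʳ _)) (Bool.∧-identityʳ _))
      AP-map : ∀ {L} → AllPairs (λ u w → A u a ≡ true → A w a ≡ true → Adj G u w) L →
        AllPairs (λ u v → restrict A w c u a ≡ true → restrict A w c v a ≡ true → Adj G u v) L
      AP-map []       = []
      AP-map (p ∷ ps) = All.map (λ {v} f r s → f (trans (sym (same _)) r) (trans (sym (same v)) s)) p ∷ AP-map ps

  size : (Fin x → Bool) → ℕ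
  size C = ∑ (allFin x) (λ c → ⟦ C c ⟧)

  size-delete : ∀ C a → C a ≡ true → size (λ c → C c ∧ not (a == c)) ≡ size C ∸ 1
  size-delete C a e = sym (begin
    size C ∸ 1
      ≡⟨ cong (_∸ 1) (∑-cong (allFin x) split) ⟩
    ∑ (allFin x) (λ c → ⟦ C c ∧ not (a == c) ⟧ + ⟦ a == c ⟧) ∸ 1
      ≡⟨ cong (_∸ 1) (trans (∑-+ (allFin x) _ _) (cong (size C′ +_) (∑-indicator a))) ⟩
    size C′ + 1 ∸ 1 ≡⟨ m+n∸n≡m (size C′) 1 ⟩
    size C′ ∎)
    where
    open ≡-Reasoning
    C′ : Fin x → Bool
    C′ c = C c ∧ not (a == c)
    split : ∀ c → ⟦ C c ⟧ ≡ ⟦ C c ∧ not (a == c) ⟧ + ⟦ a == c ⟧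
    split c with a Fin.≟ c
    split .a | yes refl rewrite e = refl
    split c  | no _ = sym (trans (+-identityʳ _) (cong ⟦_⟧ (Bool.∧-identityʳ (C c))))

  size-all : size (λ _ → true) ≡ x
  size-all = go x
    where
    go : ∀ x → ∑ (allFin x) (λ _ → 1) ≡ x
    go zero    = refl
    go (suc x) = trans (∑-allFin-suc x (λ _ → 1)) (cong suc (go x))

-- The complement of `G` and the count `N`.

module Complement {n} (G : Graph n) where

  h : Fin n → Fin n → Bool
  h u v = not (adj G u v) ∧ not (u == v)

  h-sym : ∀ u v → h u v ≡ h v u
  h-sym u v = cong₂ (λ a b → not a ∧ not b) (Graph.sym G u v) (==-sym u v)
    where
    ==-sym : ∀ u v → (u == v) ≡ (v == u)
    ==-sym u v with v Fin.≟ u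
    ... | yes refl = dec-true (v Fin.≟ v) refl
    ... | no  v≢u  = dec-false (u Fin.≟ v) (v≢u ∘ sym)

  h⇒¬adj : ∀ {u v} → h u v ≡ true → ¬ Adj G u v
  h⇒¬adj {u} {v} e a rewrite a = case e of λ ()

  h⇒≢ : ∀ {u v} → h u v ≡ true → u ≢ v
  h⇒≢ {u} e refl rewrite dec-true (u Fin.≟ u) refl | Bool.∧-zeroʳ (not (adj G u u)) = case e of λ ()

  h-≢ : ∀ {u v} → u ≢ v → h u v ≡ not (adj G u v)
  h-≢ {u} {v} u≢v rewrite dec-false (u Fin.≟ v) u≢v = Bool.∧-identityʳ _

  h-false : ∀ {u v} → u ≢ v → h u v ≡ false → Adj G u v
  h-false {u} {v} u≢v e with adj G u v | trans (sym (h-≢ u≢v)) e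
  ... | true | _ = refl

  triangle-free : ¬ IndepSet G 3 → ∀ {u v w} → h u v ≡ true → h v w ≡ true → h u w ≡ true → ⊥
  triangle-free ¬i {u} {v} {w} uv vw uw = ¬i (f , inj , ind)
    where
    flip′ : ∀ {a b} → h a b ≡ true → h b a ≡ true
    flip′ {a} {b} e = trans (h-sym b a) e
    f : Fin 3 → Fin n
    f zero             = u
    f (suc zero)       = v
    f (suc (suc zero)) = w
    related : ∀ i j → i ≡ j ⊎ h (f i) (f j) ≡ true
    related zero             zero             = inj₁ refl
    related zero             (suc zero)       = inj₂ uv
    related zero             (suc (suc zero)) = inj₂ uw
    related (suc zero)       zero             = inj₂ (flip′ uv)
    related (suc zero)       (suc zero)       = inj₁ refl
    related (suc zero)       (suc (suc zero)) = inj₂ vw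
    related (suc (suc zero)) zero             = inj₂ (flip′ uw)
    related (suc (suc zero)) (suc zero)       = inj₂ (flip′ vw)
    related (suc (suc zero)) (suc (suc zero)) = inj₁ refl
    inj : ∀ i j → f i ≡ f j → i ≡ j
    inj i j e with related i j
    ... | inj₁ i≡j = i≡j
    ... | inj₂ r   = ⊥-elim (h⇒≢ r e)
    ind : ∀ i j → ¬ Adj G (f i) (f j)
    ind i j a with related i j
    ... | inj₁ refl = case trans (sym a) (irrefl G (f i)) of λ ()
    ... | inj₂ r    = h⇒¬adj r a

  open Count h using (N; N-cons)

  module _ (tri : ∀ {u v w} → h u v ≡ true → h v w ≡ true → h u w ≡ true → ⊥) (x : ℕ) where
    open ListColouring G x

    -- After `v` receives `c`, the colour stays available exactly at the vertices related to `v` by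
    -- `h`, and these form a clique of `G` because `h` has no triangles. By `col-split` at most one
    -- of them takes `c` as well; then `c` leaves every list, the lists are uniform again, and the
    -- recursion of `N` appears.
    col≡N : ∀ m L C → length L ≤ m → Unique L → col L (λ _ → C) ≡ N L (size C)
    col≡N m       []      C l       _ = refl
    col≡N (suc m) (v ∷ L) C (s≤s l) (v∉ ∷ uq) = begin
      ∑ (allFin x) (λ c → ⟦ C c ⟧ * col L (restrict (λ _ → C) v c))
        ≡⟨ ∑-cong (allFin x) term ⟩
      ∑ (allFin x) (λ c → ⟦ C c ⟧ * R)
        ≡⟨ ∑-*ʳ (allFin x) _ R ⟩
      size C * R
        ≡⟨ N-cons v L (size C) ⟨
      N (v ∷ L) (size C) ∎
      where
      open ≡-Reasoning
      R = N L (size C ∸ 1) + sumP (λ u L′ → ⟦ h v u ⟧ * N L′ (size C ∸ 1)) L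
      absorb : ∀ p q r → (p ∧ not (q ∧ r)) ∧ not r ≡ p ∧ not r
      absorb false _     _     = refl
      absorb true  false false = refl
      absorb true  false true  = refl
      absorb true  true  false = refl
      absorb true  true  true  = refl
      term : ∀ c → ⟦ C c ⟧ * col L (restrict (λ _ → C) v c) ≡ ⟦ C c ⟧ * R
      term c with C c in eq
      ... | false = refl
      ... | true  = cong (_+ 0) (trans (col-split L A c (clique v∉ uq)) (cong₂ _+_
              (trans (col-cong L λ u _ c′ → absorb (C c′) _ _) (IH L l uq))
              (sumP-cong L λ u L′ p → cong₂ (λ b s → ⟦ b ⟧ * s)
                (trans (allowed u) (sym (h-≢ (All.lookup v∉ (∈-resp-↭ (↭-sym p) (here refl))))))
                (trans (col-cong L′ λ u _ c′ → absorb (C c′) _ _)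
                  (IH L′ (≤-trans (<⇒≤ (≤-reflexive (sym (↭-length p)))) l) (tail (Unique-resp-↭ p uq)))))))
        where
        A = restrict (λ _ → C) v c
        tail : ∀ {u L} → Unique (u ∷ L) → Unique L
        tail (_ ∷ uq) = uq
        IH : ∀ M → length M ≤ m → Unique M → col M (λ _ c′ → C c′ ∧ not (c == c′)) ≡ N M (size C ∸ 1)
        IH M l uq = trans (col≡N m M _ l uq) (cong (N M) (size-delete C c eq))
        allowed : ∀ u → A u c ≡ not (adj G v u)
        allowed u rewrite eq | dec-true (c Fin.≟ c) refl = cong not (Bool.∧-identityʳ _)
        clique : ∀ {M} → All (v ≢_) M → Unique M →
          AllPairs (λ u w → A u c ≡ true → A w c ≡ true → Adj G u w) M
        clique []         []         = []
        clique (v≢u ∷ ne) (u∉ ∷ uq) = All.zipWith (λ {w} (v≢w , u≢w) au aw → ok v≢u v≢w u≢w au aw) (ne , u∉) ∷ clique ne uq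
          where
          ok : ∀ {u w} → v ≢ u → v ≢ w → u ≢ w → A u c ≡ true → A w c ≡ true → Adj G u w
          ok {u} {w} v≢u v≢w u≢w au aw with h u w in huw
          ... | false = h-false u≢w huw
          ... | true  = ⊥-elim (tri (trans (h-≢ v≢u) (trans (sym (allowed u)) au)) huw
                                    (trans (h-≢ v≢w) (trans (sym (allowed w)) aw)))

-- Counting the colourings enumerated by `allFuns`.

module _ {X : Set} where

  length-filter-⇔ : {P Q : X → Set} (P? : Decidable P) (Q? : Decidable Q) →
    (∀ a → P a → Q a) → (∀ a → Q a → P a) → ∀ as → length (filter P? as) ≡ length (filter Q? as)
  length-filter-⇔ P? Q? f g []       = refl
  length-filter-⇔ P? Q? f g (a ∷ as) with P? a | Q? a
  ... | yes p | yes q = cong suc (length-filter-⇔ P? Q? f g as)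
  ... | no ¬p | no ¬q = length-filter-⇔ P? Q? f g as
  ... | yes p | no ¬q = ⊥-elim (¬q (f a p))
  ... | no ¬p | yes q = ⊥-elim (¬p (g a q))

  length-filter-map : {Y : Set} {P : X → Set} (P? : Decidable P) (g : Y → X) → ∀ bs →
    length (filter P? (map g bs)) ≡ length (filter (P? ∘ g) bs)
  length-filter-map P? g []       = refl
  length-filter-map P? g (b ∷ bs) with P? (g b)
  ... | yes _ = cong suc (length-filter-map P? g bs)
  ... | no _  = length-filter-map P? g bs

  length-filter-none : {P : X → Set} (P? : Decidable P) → (∀ a → ¬ P a) → ∀ as → length (filter P? as) ≡ 0
  length-filter-none P? ¬p []       = refl
  length-filter-none P? ¬p (a ∷ as) with P? a
  ... | yes p = ⊥-elim (¬p a p)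
  ... | no _  = length-filter-none P? ¬p as

  length-filter-concatMap : {Y C : Set} {P : X → Set} (P? : Decidable P) (g : C → Y → X) → ∀ bs cs →
    length (filter P? (concatMap (λ c → map (g c) bs) cs)) ≡ ∑ cs (λ c → length (filter (P? ∘ g c) bs))
  length-filter-concatMap P? g bs []       = refl
  length-filter-concatMap P? g bs (c ∷ cs) = trans
    (cong length (filter-++ P? (map (g c) bs) _))
    (trans (length-++ (filter P? (map (g c) bs)))
           (cong₂ _+_ (length-filter-map P? (g c) bs) (length-filter-concatMap P? g bs cs)))

module _ {n} (G : Graph n) (x : ℕ) where
  open ListColouring G x

  Good : ∀ {m} → (Fin m → Fin n) → Lists → (Fin m → Fin x) → Set
  Good e A f = (∀ i → A (e i) (f i) ≡ true) × (∀ i j → Adj G (e i) (e j) → f i ≢ f j)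

  good? : ∀ {m} (e : Fin m → Fin n) A → Decidable (Good e A)
  good? e A f = all? (λ i → A (e i) (f i) Bool.≟ true) ×-dec
    all? (λ i → all? (λ j → (adj G (e i) (e j) Bool.≟ true) →-dec ¬? (f i Fin.≟ f j)))

  ∧-true : ∀ {p q} → p ∧ q ≡ true → p ≡ true × q ≡ true
  ∧-true {true} {true} _ = refl , refl

  module _ {m} (e : Fin (suc m) → Fin n) (A : Lists) (f : Fin (suc m) → Fin x) where

    good-suc : Good e A f → Good (e ∘ suc) (restrict A (e zero) (f zero)) (f ∘ suc)
    good-suc (al , pr) = ok , λ i j → pr (suc i) (suc j)
      where
      ok : ∀ i → A (e (suc i)) (f (suc i)) ∧ not (adj G (e zero) (e (suc i)) ∧ (f zero == f (suc i))) ≡ true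
      ok i with adj G (e zero) (e (suc i)) in q
      ... | false = trans (Bool.∧-identityʳ _) (al (suc i))
      ... | true  = cong₂ (λ p b → p ∧ not b) (al (suc i)) (dec-false (f zero Fin.≟ f (suc i)) (pr zero (suc i) q))

    good-cons : A (e zero) (f zero) ≡ true →
      Good (e ∘ suc) (restrict A (e zero) (f zero)) (f ∘ suc) → Good e A f
    good-cons a0 (al , pr) = al′ , pr′
      where
      al′ : ∀ i → A (e i) (f i) ≡ true
      al′ zero    = a0
      al′ (suc i) = proj₁ (∧-true (al i))
      apart : ∀ j → Adj G (e zero) (e (suc j)) → f zero ≢ f (suc j)
      apart j a q = case trans (sym (proj₂ (∧-true (al j))))
        (cong₂ (λ p b → not (p ∧ b)) a (dec-true (f zero Fin.≟ f (suc j)) q)) of λ ()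
      pr′ : ∀ i j → Adj G (e i) (e j) → f i ≢ f j
      pr′ zero    zero    a _ = case trans (sym a) (irrefl G (e zero)) of λ ()
      pr′ zero    (suc j) a q = apart j a q
      pr′ (suc i) zero    a q = apart i (trans (Graph.sym G _ _) a) (sym q)
      pr′ (suc i) (suc j) a q = pr i j a q

  -- `allFuns` prepends the value at the first vertex, so the enumeration `e` is peeled off from the
  -- front and the lists record the constraints from values already chosen.
  good-count : ∀ m (e : Fin m → Fin n) A → length (filter (good? e A) (allFuns m x)) ≡ col (tabulate e) A
  good-count zero    e A = length-filter-⇔ (good? e A) (λ _ → yes tt) (λ _ _ → tt)
    (λ _ _ → (λ ()) , λ ()) (allFuns zero x)
  good-count (suc m) e A = trans (length-filter-concatMap (good? e A) _ (allFuns m x) (allFin x))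
    (∑-cong (allFin x) term)
    where
    term : ∀ c → _ ≡ ⟦ A (e zero) c ⟧ * col (tabulate (e ∘ suc)) (restrict A (e zero) c)
    term c with A (e zero) c in q
    ... | false = length-filter-none _ (λ f g → case trans (sym (proj₁ g zero)) q of λ ()) (allFuns m x)
    ... | true  = trans
      (length-filter-⇔ _ (good? (e ∘ suc) (restrict A (e zero) c)) (λ f → good-suc e A _) (λ f → good-cons e A _ q) (allFuns m x))
      (trans (good-count m (e ∘ suc) (restrict A (e zero) c)) (sym (+-identityʳ _)))

P≡N : ∀ {n} (G : Graph n) → ¬ IndepSet G 3 → ∀ x → P G x ≡ Count.N (Complement.h G) (allFin n) x
P≡N {n} G ¬i x = begin
  P G x
    ≡⟨ length-filter-⇔ (isProper? G) (good? G x (λ i → i) (λ _ _ → true)) (λ f p → (λ _ → refl) , p) (λ f → proj₂) (allFuns n x) ⟩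
  length (filter (good? G x (λ i → i) (λ _ _ → true)) (allFuns n x))
    ≡⟨ good-count G x n (λ i → i) (λ _ _ → true) ⟩
  col (allFin n) (λ _ _ → true)
    ≡⟨ Complement.col≡N G (Complement.triangle-free G ¬i) x _ (allFin n) (λ _ → true) ≤-refl (allFin⁺ n) ⟩
  Count.N (Complement.h G) (allFin n) (size (λ _ → true))
    ≡⟨ cong (Count.N (Complement.h G) (allFin n)) size-all ⟩
  Count.N (Complement.h G) (allFin n) x ∎
  where
  open ≡-Reasoning
  open ListColouring G x

-- Matchings of the complement and colourings of `G`.

module Chromatic {n} (G : Graph n) (¬i₃ : ¬ IndepSet G 3) where

  open Complement G public
  open TriangleFree h h-sym (triangle-free ¬i₃) public

  ProperOn : List (Fin n) → ℕ → Set
  ProperOn L m = Σ (Fin n → ℕ) λ c →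
    (∀ i → i ∈ L → c i < m) × (∀ i j → i ∈ L → j ∈ L → Adj G i j → c i ≢ c j)

  ¬adj-self : ∀ {v} → ¬ Adj G v v
  ¬adj-self {v} a = case trans (sym a) (irrefl G v) of λ ()

  -- `u` and `w` may coincide, so a single lemma adds both singleton and two-element colour classes.
  new-colour : ∀ {L m} u w → ¬ Adj G u w → ProperOn L m → ProperOn (u ∷ w ∷ L) (suc m)
  new-colour {L} {m} u w ¬uw (c , c< , pr) = c′ , bounded , proper
    where
    InPair : Fin n → Set
    InPair i = i ≡ u ⊎ i ≡ w
    inPair? : ∀ i → Dec (InPair i)
    inPair? i with i Fin.≟ u | i Fin.≟ w
    ... | yes e | _     = yes (inj₁ e)
    ... | no _  | yes e = yes (inj₂ e)
    ... | no ¬e | no ¬f = no λ { (inj₁ e) → ¬e e ; (inj₂ f) → ¬f f }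
    old : ∀ {i} → i ∈ u ∷ w ∷ L → ¬ InPair i → i ∈ L
    old (here e)          ¬p = ⊥-elim (¬p (inj₁ e))
    old (there (here e))  ¬p = ⊥-elim (¬p (inj₂ e))
    old (there (there i)) ¬p = i
    same : ∀ {i j} → InPair i → InPair j → ¬ Adj G i j
    same (inj₁ refl) (inj₁ refl) a = ¬adj-self a
    same (inj₁ refl) (inj₂ refl) a = ¬uw a
    same (inj₂ refl) (inj₁ refl) a = ¬uw (trans (Graph.sym G _ _) a)
    same (inj₂ refl) (inj₂ refl) a = ¬adj-self a
    c′ : Fin n → ℕ
    c′ i with inPair? i
    ... | yes _ = m
    ... | no _  = c i
    bounded : ∀ i → i ∈ u ∷ w ∷ L → c′ i < suc m
    bounded i k with inPair? i
    ... | yes _ = ≤-refl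
    ... | no ¬p = m≤n⇒m≤1+n (c< i (old k ¬p))
    proper : ∀ i j → i ∈ u ∷ w ∷ L → j ∈ u ∷ w ∷ L → Adj G i j → c′ i ≢ c′ j
    proper i j k l a with inPair? i | inPair? j
    ... | yes p | yes q = λ _ → same p q a
    ... | yes _ | no ¬q = λ e → <⇒≢ (c< j (old l ¬q)) (sym e)
    ... | no ¬p | yes _ = λ e → <⇒≢ (c< i (old k ¬p)) e
    ... | no ¬p | no ¬q = pr i j (old k ¬p) (old l ¬q) a

  proper-⊆ : ∀ {L L′ m} → (∀ {i} → i ∈ L → i ∈ L′) → ProperOn L′ m → ProperOn L m
  proper-⊆ sub (c , c< , pr) = c , (λ i k → c< i (sub k)) , λ i j k l → pr i j (sub k) (sub l)

  -- Each pair saves one colour compared with giving all `m + j` entries different colours.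
  Mat⇒proper : ∀ {j} L m → length L ≡ m + j → Mat j L → ProperOn L m
  Mat⇒proper []      m       l empty = (λ _ → 0) , (λ _ ()) , λ _ _ ()
  Mat⇒proper (v ∷ L) (suc m) l empty = proper-⊆ there
    (new-colour v v ¬adj-self (Mat⇒proper L m (suc-injective l) empty))
  Mat⇒proper (v ∷ L) zero    () empty
  -- With `m = 0` the list would have `suc j` entries and contain `suc j` disjoint pairs.
  Mat⇒proper {suc j} L zero l m@(pair _ _ _) =
    ⊥-elim (<⇒≱ (m<m+n (suc j) (s≤s z≤n)) (subst (suc j + suc j ≤_) l (Mat-length m)))
  Mat⇒proper {suc j} L (suc m) l (pair {u = u} {w} {L′} p e mt) = proper-⊆ (∈-resp-↭ p)
    (new-colour u w (h⇒¬adj e) (Mat⇒proper L′ m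
      (suc-injective (suc-injective (trans (sym (↭-length p)) (trans l (cong suc (+-suc m j)))))) mt))

  Mat⇒colouring : ∀ {j} m → n ≡ m + j → Mat j (allFin n) → Σ (Fin n → Fin m) (IsProper G)
  Mat⇒colouring m e mt with c , c< , pr ← Mat⇒proper (allFin n) m (trans (length-tabulate (λ i → i)) e) mt =
    (λ i → fromℕ< (c< i (∈-allFin i))) ,
    λ i j a q → pr i j (∈-allFin i) (∈-allFin j) a
      (trans (sym (toℕ-fromℕ< (c< i (∈-allFin i)))) (trans (cong toℕ q) (toℕ-fromℕ< (c< j (∈-allFin j)))))

  -- Three vertices of one colour would be independent, so no colour is used more than twice.
  colouring⇒n≤2k : ∀ {k} → Σ (Fin n → Fin k) (IsProper G) → n ≤ k + k
  colouring⇒n≤2k {k} (c , pr) = ≮⇒≥ λ lt → case pigeonhole lt g of λ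
    { (i , j , i<j , e) → collide i j i<j e }
    where
    earlier? : ∀ i → Dec (∃ λ j → toℕ j < toℕ i × c j ≡ c i)
    earlier? i = any? λ j → (toℕ j <? toℕ i) ×-dec (c j Fin.≟ c i)
    -- The first vertex of each colour goes to the left copy of Fin k, the others to the right copy.
    g : Fin n → Fin (k + k)
    g i with earlier? i
    ... | yes _ = k ↑ʳ c i
    ... | no _  = c i ↑ˡ k
    left≢right : ∀ {a b : Fin k} → a ↑ˡ k ≢ k ↑ʳ b
    left≢right {a} {b} e = case trans (sym (splitAt-↑ˡ k a k)) (trans (cong (splitAt k) e) (splitAt-↑ʳ k k b)) of λ ()
    monochromatic : ∀ {i j} → toℕ i < toℕ j → c i ≡ c j → h i j ≡ true
    monochromatic {i} {j} i<j e = trans (h-≢ (λ i≡j → <⇒≢ i<j (cong toℕ i≡j))) (cong not adj-false)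
      where
      adj-false : adj G i j ≡ false
      adj-false with adj G i j in q
      ... | true  = ⊥-elim (pr i j q e)
      ... | false = refl
    collide : ∀ i j → toℕ i < toℕ j → g i ≡ g j → ⊥
    collide i j i<j e with earlier? i | earlier? j
    ... | no _ | yes _ = left≢right e
    ... | yes _ | no _ = left≢right (sym e)
    ... | no _ | no ¬j = ¬j (i , i<j , ↑ˡ-injective k _ _ e)
    ... | yes (i′ , i′<i , e′) | yes _ = triangle-free ¬i₃ (monochromatic i′<i e′) (monochromatic i<j (↑ʳ-injective k _ _ e))
      (monochromatic (<-trans i′<i i<j) (trans e′ (↑ʳ-injective k _ _ e)))

-- Consequences of 2-connectedness.

module _ {n} (G : Graph n) where

  open Complement G

  first-step : ∀ {S v u} → v ≢ u → Walk G S v u → ∃ λ w → Adj G v w × S w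
  first-step v≢u (here _)                      = ⊥-elim (v≢u refl)
  first-step v≢u (step _ a (here s))           = _ , a , s
  first-step v≢u (step _ a (step s _ _))       = _ , a , s

  third-vertex : 3 ≤ n → ∀ (a b : Fin n) → ∃ λ c → a ≢ c × b ≢ c
  third-vertex 3≤n a b with any? (λ c → ¬? (a Fin.≟ c) ×-dec ¬? (b Fin.≟ c))
  ... | yes r = r
  ... | no ¬r = ⊥-elim (case pigeonhole 3≤n f of λ { (i , j , i<j , e) → <⇒≢ i<j (cong toℕ (f-injective i j e)) })
    where
    f : Fin n → Fin 2
    f c with a Fin.≟ c
    ... | yes _ = zero
    ... | no _  = suc zero
    f-injective : ∀ i j → f i ≡ f j → i ≡ j
    f-injective i j e with a Fin.≟ i | a Fin.≟ j
    ... | yes refl | yes refl = refl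
    ... | no ¬p | no ¬q = trans (sym (other i ¬p)) (other j ¬q)
      where
      other : ∀ c → a ≢ c → b ≡ c
      other c a≢c with b Fin.≟ c
      ... | yes e = e
      ... | no ¬e = ⊥-elim (¬r (c , a≢c , ¬e))

  -- Connectedness provides one neighbour `s`; connectedness after the removal of `s` provides
  -- another.
  two-neighbours : TwoConnected G → ∀ v → ∃₂ λ s t → Adj G v s × Adj G v t × s ≢ t
  two-neighbours (3≤n , conn , conn₂) v
    with u , v≢u , _ ← third-vertex 3≤n v v
    with s , vs , _ ← first-step v≢u (conn v u _ _)
    with u′ , v≢u′ , s≢u′ ← third-vertex 3≤n v s
    with t , vt , t≢s ← first-step v≢u′ (conn₂ s v u′ (λ { refl → case trans (sym vs) (irrefl G v) of λ () }) (≢-sym s≢u′))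
    = s , t , vs , vt , ≢-sym t≢s

  module _ (¬i₃ : ¬ IndepSet G 3) where
    open TriangleFree h h-sym (triangle-free ¬i₃)

    private
      remove : ∀ {u w : Fin n} {L} → w ∈ u ∷ L → u ≢ w → w ∈ L
      remove (here e)  ne = ⊥-elim (ne (sym e))
      remove (there i) ne = i
      adj-≢ : ∀ {u w} → Adj G u w → u ≢ w
      adj-≢ a refl = case trans (sym a) (irrefl G _) of λ ()
      adj-h : ∀ {v w} → Adj G v w → h v w ≡ false
      adj-h {v} {w} a = cong (λ b → not b ∧ not (v == w)) a

    -- Neither `v` itself nor its two neighbours in `G` are related to `v` by `h`.
    degree-bound : TwoConnected G → ∀ v → deg v (allFin n) + 3 ≤ n
    degree-bound tc v with s , t , vs , vt , s≢t ← two-neighbours tc v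
      with L₁ , p₁ ← ∈⇒↭ (∈-allFin v)
      with L₂ , p₂ ← ∈⇒↭ (remove (∈-resp-↭ p₁ (∈-allFin s)) (adj-≢ vs))
      with L₃ , p₃ ← ∈⇒↭ (remove (∈-resp-↭ p₂ (remove (∈-resp-↭ p₁ (∈-allFin t)) (adj-≢ vt))) s≢t) = begin
        deg v (allFin n) + 3     ≡⟨ cong (_+ 3) (trans (deg-↭ v p) (trans (deg-self v (s ∷ t ∷ L₃)) (cong₂ (λ a b → ⟦ a ⟧ + (⟦ b ⟧ + deg v L₃)) (adj-h vs) (adj-h vt)))) ⟩
        deg v L₃ + 3             ≤⟨ +-monoˡ-≤ 3 (deg≤length v L₃) ⟩
        length L₃ + 3            ≡⟨ +-comm (length L₃) 3 ⟩
        3 + length L₃            ≡⟨ ↭-length p ⟨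
        length (allFin n)        ≡⟨ length-tabulate (λ i → i) ⟩
        n                        ∎
      where
      open ≤-Reasoning
      p = ↭-trans p₁ (prep v (↭-trans p₂ (prep s p₃)))

    -- In `G` there are no edges between the two sides of a join, so a walk that starts on one side
    -- stays there.
    connected⇒¬join : ConnectedOn G (λ _ → ⊤) → ¬ Join (allFin n)
    connected⇒¬join conn (s ∷ S , u ∷ K , p , _ , _ , j) = crosses (here refl) (conn s u _ _)
      where
      crosses : ∀ {v} → v ∈ s ∷ S → ¬ Walk G (λ _ → ⊤) v u
      crosses i (here _) = h⇒≢ (j i (here refl)) refl
      crosses i (step {v = w} _ a r) with ∈-++⁻ (s ∷ S) (∈-resp-↭ p (∈-allFin w))
      ... | inj₁ i′ = crosses i′ r
      ... | inj₂ k  = h⇒¬adj (j i k) a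

-- Isomorphisms with `G_{k+1,k}` and `G_{k+2,k}`.

module _ {X Y : Set} where

  unique-image : ∀ {zs : List (X × Y)} → Unique (map proj₁ zs) → ∀ {i j j′} → (i , j) ∈ zs → (i , j′) ∈ zs → j ≡ j′
  unique-image _         (here refl) (here refl) = refl
  unique-image (i∉ ∷ _)  (here refl) (there q)   = ⊥-elim (All.lookup i∉ (∈-map⁺ proj₁ q) refl)
  unique-image (i∉ ∷ _)  (there p)   (here refl) = ⊥-elim (All.lookup i∉ (∈-map⁺ proj₁ p) refl)
  unique-image (_ ∷ uq)  (there p)   (there q)   = unique-image uq p q

  unique-preimage : ∀ {zs : List (X × Y)} → Unique (map proj₂ zs) → ∀ {i i′ j} → (i , j) ∈ zs → (i′ , j) ∈ zs → i ≡ i′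
  unique-preimage _         (here refl) (here refl) = refl
  unique-preimage (j∉ ∷ _)  (here refl) (there q)   = ⊥-elim (All.lookup j∉ (∈-map⁺ proj₂ q) refl)
  unique-preimage (j∉ ∷ _)  (there p)   (here refl) = ⊥-elim (All.lookup j∉ (∈-map⁺ proj₂ p) refl)
  unique-preimage (_ ∷ uq)  (there p)   (there q)   = unique-preimage uq p q

AllPairs-lookup : {X : Set} {R : X → X → Set} {zs : List X} → AllPairs R zs →
  ∀ {p q} → p ∈ zs → q ∈ zs → p ≡ q ⊎ R p q ⊎ R q p
AllPairs-lookup (r ∷ _)  (here refl) (here refl) = inj₁ refl
AllPairs-lookup (r ∷ _)  (here refl) (there j)   = inj₂ (inj₁ (All.lookup r j))
AllPairs-lookup (r ∷ _)  (there i)   (here refl) = inj₂ (inj₂ (All.lookup r i))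
AllPairs-lookup (_ ∷ rs) (there i)   (there j)   = AllPairs-lookup rs i j

module _ {n n′} (G : Graph n) (H : Graph n′) where

  SameAdj : Fin n × Fin n′ → Fin n × Fin n′ → Set
  SameAdj (i , j) (i′ , j′) = adj G i i′ ≡ adj H j j′

  -- A bijection given by its graph as a list of pairs. Comparing adjacency once for each unordered
  -- pair is enough, since symmetry and irreflexivity of both graphs supply the rest.
  matching-lists⇒≅ : ∀ zs → map proj₁ zs ↭ allFin n → map proj₂ zs ↭ allFin n′ → AllPairs SameAdj zs → G ≅ H
  matching-lists⇒≅ zs p₁ p₂ same = mk↔ₛ′ to from to-from from-to , preserves
    where
    image : ∀ i → ∃ λ j → (i , j) ∈ zs
    image i with (i , j) , k , refl ← ∈-map⁻ proj₁ (∈-resp-↭ (↭-sym p₁) (∈-allFin i)) = j , k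
    preimage : ∀ j → ∃ λ i → (i , j) ∈ zs
    preimage j with (i , j) , k , refl ← ∈-map⁻ proj₂ (∈-resp-↭ (↭-sym p₂) (∈-allFin j)) = i , k
    to : Fin n → Fin n′
    to i = proj₁ (image i)
    from : Fin n′ → Fin n
    from j = proj₁ (preimage j)
    to-from : ∀ j → to (from j) ≡ j
    to-from j = unique-image (Unique-resp-↭ (↭-sym p₁) (allFin⁺ n)) (proj₂ (image (from j))) (proj₂ (preimage j))
    from-to : ∀ i → from (to i) ≡ i
    from-to i = unique-preimage (Unique-resp-↭ (↭-sym p₂) (allFin⁺ n′)) (proj₂ (preimage (to i))) (proj₂ (image i))
    preserves : ∀ i i′ → adj G i i′ ≡ adj H (to i) (to i′)
    preserves i i′ with AllPairs-lookup same (proj₂ (image i)) (proj₂ (image i′))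
    ... | inj₂ (inj₁ e) = e
    ... | inj₂ (inj₂ e) = trans (Graph.sym G i i′) (trans e (Graph.sym H _ _))
    ... | inj₁ e with refl ← cong proj₁ e = trans (irrefl G i) (sym (irrefl H (to i)))

  ≅⇒≡ : G ≅ H → n ≡ n′
  ≅⇒≡ (φ , _) = ↔⇒≡ φ

tabulate-+ : ∀ {X : Set} m d (f : Fin (m + d) → X) →
  tabulate f ≡ tabulate (λ i → f (i ↑ˡ d)) ++ tabulate (λ i → f (m ↑ʳ i))
tabulate-+ zero    d f = refl
tabulate-+ (suc m) d f = cong (f zero ∷_) (tabulate-+ m d (f ∘ suc))

-- The vertices of G_{m+2+d, m+2}: two distinguished clique vertices, the other clique vertices
-- and the vertices of the path.
module Labels (m d : ℕ) where

  Label : Set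
  Label = Fin (suc (suc m) + d)

  mid : Fin m → Label
  mid i = suc (suc (i ↑ˡ d))

  end : Fin d → Label
  end i = suc (suc (m ↑ʳ i))

  -- Ordered as the `Pattern` records below list the vertices of `G`: path, the two attachment
  -- vertices, rest of the clique.
  labels : List Label
  labels = tabulate end ++ zero ∷ suc zero ∷ tabulate mid

  labels-↭ : labels ↭ allFin (suc (suc m) + d)
  labels-↭ = ↭-trans (++-comm (tabulate end) (zero ∷ suc zero ∷ tabulate mid))
    (prep zero (prep (suc zero) (Perm.↭-reflexive (sym (tabulate-+ m d (λ i → suc (suc i)))))))

  toℕ-mid : ∀ i → toℕ (mid i) ≡ suc (suc (toℕ i))
  toℕ-mid i = cong (2 +_) (toℕ-↑ˡ i d)

  toℕ-end : ∀ i → toℕ (end i) ≡ suc (suc (m + toℕ i))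
  toℕ-end i = cong (2 +_) (toℕ-↑ʳ m i)

<ᵇ-true : ∀ {a b} → a < b → (a <ᵇ b) ≡ true
<ᵇ-true (s≤s {zero}  l) = refl
<ᵇ-true (s≤s {suc a} l) = <ᵇ-true l

<ᵇ-false : ∀ {a b} → b ≤ a → (a <ᵇ b) ≡ false
<ᵇ-false {a}     z≤n     = refl
<ᵇ-false {suc a} (s≤s l) = <ᵇ-false l

≡ᵇ-true : ∀ a → (a ≡ᵇ a) ≡ true
≡ᵇ-true zero    = refl
≡ᵇ-true (suc a) = ≡ᵇ-true a

≡ᵇ-false : ∀ {a b} → a ≢ b → (a ≡ᵇ b) ≡ false
≡ᵇ-false {zero}  {zero}  ne = ⊥-elim (ne refl)
≡ᵇ-false {zero}  {suc b} ne = refl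
≡ᵇ-false {suc a} {zero}  ne = refl
≡ᵇ-false {suc a} {suc b} ne = ≡ᵇ-false (ne ∘ cong suc)

gadj-clique : ∀ n k {a b} → a < k → b < k → a ≢ b → gadj n k a b ≡ true
gadj-clique n k a<k b<k a≢b rewrite ≡ᵇ-false a≢b | <ᵇ-true a<k | <ᵇ-true b<k = refl

gadj-path : ∀ n k {a b} → suc k ≤ a → b < suc k →
  gadj n (suc k) a b ≡ ((a ≡ᵇ n ∸ 1) ∧ (b ≡ᵇ 1)) ∨ ((b ≡ᵇ 0) ∧ (a ≡ᵇ suc k) ∧ (suc k <ᵇ n))
gadj-path n k {a} {b} k<a b≤k
  rewrite ≡ᵇ-false {a} {b} (λ { refl → <⇒≱ b≤k k<a }) | <ᵇ-false k<a | <ᵇ-true b≤k | ≡ᵇ-false {a} {0} (λ { refl → <⇒≱ k<a z≤n })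
        | ≡ᵇ-false {b} {suc a} (λ { refl → <⇒≱ b≤k (m≤n⇒m≤1+n k<a) }) | <ᵇ-true k<a | <ᵇ-false (≤-pred b≤k)
        | Bool.∧-zeroʳ (b ≡ᵇ n ∸ 1) = cong (((a ≡ᵇ n ∸ 1) ∧ (b ≡ᵇ 1)) ∨_) (Bool.∨-identityʳ _)

gadj-next : ∀ n k {a} → suc k ≤ a → suc a < n → gadj n (suc k) a (suc a) ≡ true
gadj-next n k {a} k<a a<n
  rewrite ≡ᵇ-false {a} {suc a} (<⇒≢ ≤-refl) | <ᵇ-false k<a | ≡ᵇ-false {a} {0} (λ { refl → <⇒≱ k<a z≤n })
        | <ᵇ-true k<a | ≡ᵇ-true a | <ᵇ-true a<n = refl

module _ {X Y : Set} where

  label : ∀ K {m} → length K ≡ m → (Fin m → Y) → List (X × Y)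
  label []      {zero}  _ f = []
  label (u ∷ K) {suc m} l f = (u , f zero) ∷ label K (suc-injective l) (f ∘ suc)

  label-proj₁ : ∀ K {m} (l : length K ≡ m) f → map proj₁ (label K l f) ≡ K
  label-proj₁ []      {zero}  l f = refl
  label-proj₁ (u ∷ K) {suc m} l f = cong (u ∷_) (label-proj₁ K _ (f ∘ suc))

  label-proj₂ : ∀ K {m} (l : length K ≡ m) f → map proj₂ (label K l f) ≡ tabulate f
  label-proj₂ []      {zero}  l f = refl
  label-proj₂ (u ∷ K) {suc m} l f = cong (f zero ∷_) (label-proj₂ K _ (f ∘ suc))

  label-all : ∀ {Q : X × Y → Set} K {m} (l : length K ≡ m) f →
    (∀ u i → u ∈ K → Q (u , f i)) → All Q (label K l f)
  label-all []      {zero}  l f q = []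
  label-all (u ∷ K) {suc m} l f q = q u zero (here refl) ∷ label-all K _ (f ∘ suc) λ w i k → q w (suc i) (there k)

  label-pairs : ∀ {R : X × Y → X × Y → Set} K {m} (l : length K ≡ m) f → Unique K →
    (∀ u w i j → u ∈ K → w ∈ K → u ≢ w → i ≢ j → R (u , f i) (w , f j)) → AllPairs R (label K l f)
  label-pairs []      {zero}  l f _         r = []
  label-pairs (u ∷ K) {suc m} l f (u∉ ∷ uq) r =
    label-all K _ (f ∘ suc) (λ w j k → r u w zero (suc j) (here refl) (there k) (All.lookup u∉ k) λ ()) ∷
    label-pairs K _ (f ∘ suc) uq λ w w′ i j k k′ ne ne′ → r w w′ (suc i) (suc j) (there k) (there k′) ne (ne′ ∘ Fin.suc-injective)

unique-↭ : {X : Set} {L M : List X} → Unique L → Unique M → (∀ {v} → v ∈ L → v ∈ M) → (∀ {v} → v ∈ M → v ∈ L) → L ↭ M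
unique-↭ {L = []} {[]}    _ _ f g = ↭-refl
unique-↭ {L = []} {v ∷ M} _ _ f g = case g (here refl) of λ ()
unique-↭ {L = v ∷ L} {M} (v∉L ∷ uL) uM f g with M′ , p ← ∈⇒↭ (f (here refl)) with v∉M ∷ uM′ ← Unique-resp-↭ p uM =
  ↭-trans (prep v (unique-↭ uL uM′
      (λ i → tail (∈-resp-↭ p (f (there i))) (All.lookup v∉L i))
      (λ i → tail (g (∈-resp-↭ (↭-sym p) (there i))) (All.lookup v∉M i)))) (↭-sym p)
  where
  tail : ∀ {X : Set} {u w : X} {L} → w ∈ u ∷ L → u ≢ w → w ∈ L
  tail (here e)  ne = ⊥-elim (ne (sym e))
  tail (there i) ne = i

module Isomorphism {n} (G : Graph n) (¬i₃ : ¬ IndepSet G 3) (m d : ℕ) where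

  open Chromatic G ¬i₃
  open Labels m d

  k : ℕ
  k = suc (suc m)

  H : Graph (k + d)
  H = G[ k + d , k ]

  indep⇒adj : ∀ {M u w} → ¬ Mat 1 M → u ∈ M → w ∈ M → u ≢ w → Adj G u w
  indep⇒adj {M} {u} {w} ¬1 i j u≢w with h u w in e
  ... | false = h-false u≢w e
  ... | true  = ⊥-elim (¬1 (Mat-1 i (deg-pos j e)))

  h⇒adj-false : ∀ {u w} → h u w ≡ true → adj G u w ≡ false
  h⇒adj-false e = Bool.¬-not (h⇒¬adj e)

  non-neighbour : ∀ a K → deg a K < length K → ∃₂ λ s K′ → K ↭ s ∷ K′ × h a s ≡ false
  non-neighbour a (u ∷ K) l with h a u in e
  ... | false = u , K , ↭-refl , e
  non-neighbour a (u ∷ K) (s≤s l) | true with s , K′ , p , q ← non-neighbour a K l = s , u ∷ K′ , bring-front p , q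

  deg-all : ∀ a K → (∀ {u} → u ∈ K → h a u ≡ true) → deg a K ≡ length K
  deg-all a []      _ = refl
  deg-all a (u ∷ K) f = cong₂ (λ b s → ⟦ b ⟧ + s) (f (here refl)) (deg-all a K (f ∘ there))

  mid<k : ∀ i → toℕ (mid i) < k
  mid<k i = subst (_< k) (sym (toℕ-mid i)) (s≤s (s≤s (Fin.toℕ<n i)))

  k≤end : ∀ i → k ≤ toℕ (end i)
  k≤end i = subst (k ≤_) (sym (toℕ-end i)) (s≤s (s≤s (m≤m+n m (toℕ i))))

  mid-mid : ∀ {i j} → i ≢ j → adj H (mid i) (mid j) ≡ true
  mid-mid {i} {j} i≢j = gadj-clique (k + d) k (mid<k i) (mid<k j)
    λ e → i≢j (Fin.toℕ-injective (suc-injective (suc-injective (trans (sym (toℕ-mid i)) (trans e (toℕ-mid j))))))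

  zero-mid : ∀ i → adj H zero (mid i) ≡ true
  zero-mid i = gadj-clique (k + d) k (s≤s z≤n) (mid<k i) λ ()

  one-mid : ∀ i → adj H (suc zero) (mid i) ≡ true
  one-mid i = gadj-clique (k + d) k (s≤s (s≤s z≤n)) (mid<k i) λ ()

  end-mid : ∀ i j → adj H (end i) (mid j) ≡ false
  end-mid i j = trans (gadj-path (k + d) (suc m) (k≤end i) (mid<k j)) (cong (_∨ false) (Bool.∧-zeroʳ _))

  end-zero : ∀ i → adj H (end i) zero ≡ (toℕ (end i) ≡ᵇ k) ∧ (k <ᵇ k + d)
  end-zero i = trans (gadj-path (k + d) (suc m) {b = 0} (k≤end i) (s≤s z≤n))
    (cong (_∨ ((toℕ (end i) ≡ᵇ k) ∧ (k <ᵇ k + d))) (Bool.∧-zeroʳ (toℕ (end i) ≡ᵇ k + d ∸ 1)))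

  end-one : ∀ i → adj H (end i) (suc zero) ≡ (toℕ (end i) ≡ᵇ suc m + d)
  end-one i = trans (gadj-path (k + d) (suc m) {b = 1} (k≤end i) (s≤s (s≤s z≤n)))
    (trans (Bool.∨-identityʳ _) (Bool.∧-identityʳ _))

  module FromIso (iso : G ≅ H) where

    φ = proj₁ iso
    ψ : Label → Fin n
    ψ = Inverse.from φ

    ψ-injective : ∀ {i j} → ψ i ≡ ψ j → i ≡ j
    ψ-injective {i} {j} e = trans (sym (Inverse.strictlyInverseˡ φ i))
      (trans (cong (Inverse.to φ) e) (Inverse.strictlyInverseˡ φ j))

    ψ-adj : ∀ i j → adj G (ψ i) (ψ j) ≡ adj H i j
    ψ-adj i j = trans (proj₂ iso (ψ i) (ψ j)) (cong₂ (adj H) (Inverse.strictlyInverseˡ φ i) (Inverse.strictlyInverseˡ φ j))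

    ψ-labels : allFin n ↭ map ψ labels
    ψ-labels = ↭-trans (unique-↭ (allFin⁺ n) (Unique.map⁺ ψ-injective (allFin⁺ _))
      (λ {v} _ → subst (_∈ map ψ (allFin (k + d))) (Inverse.strictlyInverseʳ φ v) (∈-map⁺ ψ (∈-allFin (Inverse.to φ v))))
      (λ {v} _ → ∈-allFin v)) (map⁺ ψ (↭-sym labels-↭))

    ψ-h-false : ∀ {i j} → adj H i j ≡ true → h (ψ i) (ψ j) ≡ false
    ψ-h-false {i} {j} e = cong (λ b → not b ∧ not (ψ i == ψ j)) (trans (ψ-adj i j) e)

    ψ-h-true : ∀ {i j} → i ≢ j → adj H i j ≡ false → h (ψ i) (ψ j) ≡ true
    ψ-h-true {i} {j} i≢j e = trans (h-≢ (i≢j ∘ ψ-injective)) (cong not (trans (ψ-adj i j) e))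

    ψ-mid-end : ∀ i {u} → u ∈ map ψ (tabulate mid) → h (ψ (end i)) u ≡ true
    ψ-mid-end i k with _ , k′ , refl ← ∈-map⁻ ψ k with j , refl ← ∈-tabulate⁻ {f = mid} k′ =
      ψ-h-true (λ e → <⇒≱ (mid<k j) (subst (λ l → suc (suc m) ≤ toℕ l) e (k≤end i))) (end-mid i j)

    ψ-clique : ¬ Mat 1 (map ψ (zero ∷ suc zero ∷ tabulate mid))
    ψ-clique (pair p e _)
      with i , i∈ , refl ← ∈-map⁻ ψ (∈-resp-↭ (↭-sym p) (here refl))
         | j , j∈ , refl ← ∈-map⁻ ψ (∈-resp-↭ (↭-sym p) (there (here refl))) =
      case trans (sym e) (ψ-h-false (gadj-clique (k + d) k (small i∈) (small j∈)
        λ q → h⇒≢ e (cong ψ (Fin.toℕ-injective q)))) of λ ()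
      where
      small : ∀ {i} → i ∈ zero ∷ suc zero ∷ tabulate mid → toℕ i < k
      small (here refl)         = s≤s z≤n
      small (there (here refl)) = s≤s (s≤s z≤n)
      small (there (there i∈)) with j , refl ← ∈-tabulate⁻ {f = mid} i∈ = mid<k j

    mids-length : length (map ψ (tabulate mid)) ≡ m
    mids-length = trans (length-map ψ (tabulate mid)) (length-tabulate mid)

module Isomorphism₁ {n} (G : Graph n) (¬i₃ : ¬ IndepSet G 3) (m : ℕ) (n≡ : n ≡ suc (suc m) + 1) where

  open Chromatic G ¬i₃
  open Isomorphism G ¬i₃ m 1
  open Labels m 1

  -- `G_{k+1,k}` as seen in the complement of `G`: `c` is the path vertex, `s` and `t` its two
  -- neighbours in the clique. It links the numerical `Extremal₁` with the isomorphism, and both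
  -- directions of the equality case pass through it.
  record Pattern : Set where
    field
      c s t  : Fin n
      K      : List (Fin n)
      perm   : allFin n ↭ c ∷ s ∷ t ∷ K
      clique : ¬ Mat 1 (s ∷ t ∷ K)
      cs     : h c s ≡ false
      ct     : h c t ≡ false
      cK     : ∀ {u} → u ∈ K → h c u ≡ true
      len    : length K ≡ m

  end-zero-true : adj H (end zero) zero ≡ true
  end-zero-true = trans (end-zero zero) (cong₂ _∧_
    (trans (cong (_≡ᵇ k) (trans (toℕ-end zero) (cong (2 +_) (+-identityʳ m)))) (≡ᵇ-true k))
    (<ᵇ-true (≤-reflexive (+-comm 1 k))))

  end-one-true : adj H (end zero) (suc zero) ≡ true
  end-one-true = trans (end-one zero) (trans (cong₂ _≡ᵇ_ (trans (toℕ-end zero) (cong (2 +_) (+-identityʳ m)))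
    (cong suc (+-comm m 1))) (≡ᵇ-true k))

  pattern⇒≅ : Pattern → G ≅ H
  pattern⇒≅ pat = matching-lists⇒≅ G H zs perm₁ perm₂ pairs
    where
    open Pattern pat
    zs = (c , end zero) ∷ (s , zero) ∷ (t , suc zero) ∷ label K len mid
    perm₁ : map proj₁ zs ↭ allFin n
    perm₁ = subst (λ M → c ∷ s ∷ t ∷ M ↭ allFin n) (sym (label-proj₁ K len mid)) (↭-sym perm)
    perm₂ : map proj₂ zs ↭ allFin (k + 1)
    perm₂ = subst (λ M → end zero ∷ zero ∷ suc zero ∷ M ↭ allFin (k + 1)) (sym (label-proj₂ K len mid)) labels-↭
    pairs : AllPairs (SameAdj G H) zs
    pairs with (c≢s ∷ c≢t ∷ c∉) ∷ (s≢t ∷ s∉) ∷ t∉ ∷ uq ← Unique-resp-↭ perm (allFin⁺ n) =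
      (trans (h-false c≢s cs) (sym end-zero-true) ∷ trans (h-false c≢t ct) (sym end-one-true) ∷
        label-all K len mid λ u i j → trans (h⇒adj-false (cK j)) (sym (end-mid zero i))) ∷
      (trans (indep⇒adj clique (here refl) (there (here refl)) s≢t)
             (sym (gadj-clique (k + 1) k {0} {1} (s≤s z≤n) (s≤s (s≤s z≤n)) λ ())) ∷
        label-all K len mid λ u i j →
          trans (indep⇒adj clique (here refl) (there (there j)) (All.lookup s∉ j)) (sym (zero-mid i))) ∷
      label-all K len mid (λ u i j →
        trans (indep⇒adj clique (there (here refl)) (there (there j)) (All.lookup t∉ j)) (sym (one-mid i))) ∷
      label-pairs K len mid uq λ u w i j u∈ w∈ u≢w i≢j →
        trans (indep⇒adj clique (there (there u∈)) (there (there w∈)) u≢w) (sym (mid-mid i≢j))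

  ≅⇒pattern : G ≅ H → Pattern
  ≅⇒pattern iso = record
    { perm = ψ-labels ; clique = ψ-clique
    ; cs = ψ-h-false end-zero-true ; ct = ψ-h-false end-one-true ; cK = ψ-mid-end zero ; len = mids-length }
    where open FromIso iso

  rest-length : ∀ {c K} → allFin n ↭ c ∷ K → length K ≡ suc (suc m)
  rest-length p = suc-injective (trans (sym (↭-length p)) (trans (length-tabulate (λ i → i)) (trans n≡ (+-comm k 1))))

  -- `c` is related to `m` of the `m + 2` entries of `K`, so two unrelated ones can be taken out in
  -- turn, and the count forces all others to be related to it.
  extremal⇒pattern : Extremal₁ m (allFin n) → Pattern
  extremal⇒pattern (c , K , p , ¬1 , dc)
    with s , K₁ , p₁ , cs ← non-neighbour c K (subst₂ _<_ (sym dc) (sym (rest-length p)) (n≤1+n (suc m)))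
    with t , K₂ , p₂ , ct ← non-neighbour c K₁ (subst₂ _<_ (trans (sym dc) (trans (deg-↭ c p₁) (cong (λ b → ⟦ b ⟧ + deg c K₁) cs)))
           (suc-injective (trans (sym (rest-length p)) (↭-length p₁))) ≤-refl) = record
    { perm = ↭-trans p (prep c q) ; clique = λ e → ¬1 (Mat-↭ (↭-sym q) e) ; cs = cs ; ct = ct
    ; cK = deg-full c K₂ (≤-reflexive (trans l₂ (trans (sym dc) (trans (deg-↭ c q) (cong₂ (λ a b → ⟦ a ⟧ + (⟦ b ⟧ + deg c K₂)) cs ct)))))
    ; len = l₂ }
    where
    q : K ↭ s ∷ t ∷ K₂
    q = ↭-trans p₁ (prep s p₂)
    l₂ : length K₂ ≡ m
    l₂ = suc-injective (suc-injective (trans (sym (↭-length q)) (rest-length p)))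

  pattern⇒N : Pattern → ∀ z → N (allFin n) (suc (suc (z + m))) ≡ fall (suc (suc (z + m))) (suc (suc m)) * (z + m)
  pattern⇒N pat z = trans (N-star-length m z (trans (length-tabulate (λ i → i)) n≡) perm clique)
    (cong (λ i → fall (suc (suc (z + m))) (suc (suc m)) * (z + i))
      (trans (cong₂ (λ a b → ⟦ a ⟧ + (⟦ b ⟧ + deg c K)) cs ct) (trans (deg-all c K cK) len)))
    where open Pattern pat

module Isomorphism₂ {n} (G : Graph n) (¬i₃ : ¬ IndepSet G 3) (m : ℕ) (n≡ : n ≡ suc (suc m) + 2) where

  open Chromatic G ¬i₃
  open Isomorphism G ¬i₃ m 2
  open Labels m 2

  -- The path of `G_{k+2,k}` runs `s`, `a`, `b`, `t`; all other pairs between `a` or `b` and the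
  -- clique are related by `h`.
  record Pattern : Set where
    field
      a b s t : Fin n
      K       : List (Fin n)
      perm    : allFin n ↭ a ∷ b ∷ s ∷ t ∷ K
      clique  : ¬ Mat 1 (s ∷ t ∷ K)
      ab      : h a b ≡ false
      as      : h a s ≡ false
      at      : h a t ≡ true
      aK      : ∀ {u} → u ∈ K → h a u ≡ true
      bs      : h b s ≡ true
      bt      : h b t ≡ false
      bK      : ∀ {u} → u ∈ K → h b u ≡ true
      len     : length K ≡ m

  toℕ-end₀ : toℕ (end zero) ≡ k
  toℕ-end₀ = trans (toℕ-end zero) (cong (2 +_) (+-identityʳ m))

  toℕ-end₁ : toℕ (end (suc zero)) ≡ suc k
  toℕ-end₁ = trans (toℕ-end (suc zero)) (cong (2 +_) (+-comm m 1))

  last : suc m + 2 ≡ suc k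
  last = cong suc (+-comm m 2)

  end₀-zero : adj H (end zero) zero ≡ true
  end₀-zero = trans (end-zero zero) (cong₂ _∧_ (trans (cong (_≡ᵇ k) toℕ-end₀) (≡ᵇ-true k))
    (<ᵇ-true (≤-trans (n≤1+n (suc k)) (≤-reflexive (+-comm 2 k)))))

  end₀-one : adj H (end zero) (suc zero) ≡ false
  end₀-one = trans (end-one zero) (trans (cong₂ _≡ᵇ_ toℕ-end₀ last) (≡ᵇ-false (<⇒≢ (≤-refl {suc k}))))

  end₁-zero : adj H (end (suc zero)) zero ≡ false
  end₁-zero = trans (end-zero (suc zero))
    (cong (_∧ (k <ᵇ k + 2)) (trans (cong (_≡ᵇ k) toℕ-end₁) (≡ᵇ-false (≢-sym (<⇒≢ (≤-refl {suc k}))))))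

  end₁-one : adj H (end (suc zero)) (suc zero) ≡ true
  end₁-one = trans (end-one (suc zero)) (trans (cong₂ _≡ᵇ_ toℕ-end₁ last) (≡ᵇ-true (suc k)))

  end₀-end₁ : adj H (end zero) (end (suc zero)) ≡ true
  end₀-end₁ = trans (cong₂ (gadj (k + 2) k) toℕ-end₀ toℕ-end₁)
    (gadj-next (k + 2) (suc m) ≤-refl (≤-reflexive (+-comm 2 k)))

  pattern⇒≅ : Pattern → G ≅ H
  pattern⇒≅ pat = matching-lists⇒≅ G H zs perm₁ perm₂ pairs
    where
    open Pattern pat
    zs = (a , end zero) ∷ (b , end (suc zero)) ∷ (s , zero) ∷ (t , suc zero) ∷ label K len mid
    perm₁ : map proj₁ zs ↭ allFin n
    perm₁ = subst (λ M → a ∷ b ∷ s ∷ t ∷ M ↭ allFin n) (sym (label-proj₁ K len mid)) (↭-sym perm)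
    perm₂ : map proj₂ zs ↭ allFin (k + 2)
    perm₂ = subst (λ M → end zero ∷ end (suc zero) ∷ zero ∷ suc zero ∷ M ↭ allFin (k + 2)) (sym (label-proj₂ K len mid)) labels-↭
    pairs : AllPairs (SameAdj G H) zs
    pairs with (a≢b ∷ a≢s ∷ a≢t ∷ a∉) ∷ (b≢s ∷ b≢t ∷ b∉) ∷ (s≢t ∷ s∉) ∷ t∉ ∷ uq ← Unique-resp-↭ perm (allFin⁺ n) =
      (trans (h-false a≢b ab) (sym end₀-end₁) ∷ trans (h-false a≢s as) (sym end₀-zero) ∷
        trans (h⇒adj-false at) (sym end₀-one) ∷
        label-all K len mid λ u i j → trans (h⇒adj-false (aK j)) (sym (end-mid zero i))) ∷
      (trans (h⇒adj-false bs) (sym end₁-zero) ∷ trans (h-false b≢t bt) (sym end₁-one) ∷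
        label-all K len mid λ u i j → trans (h⇒adj-false (bK j)) (sym (end-mid (suc zero) i))) ∷
      (trans (indep⇒adj clique (here refl) (there (here refl)) s≢t)
             (sym (gadj-clique (k + 2) k {0} {1} (s≤s z≤n) (s≤s (s≤s z≤n)) λ ())) ∷
        label-all K len mid λ u i j →
          trans (indep⇒adj clique (here refl) (there (there j)) (All.lookup s∉ j)) (sym (zero-mid i))) ∷
      label-all K len mid (λ u i j →
        trans (indep⇒adj clique (there (here refl)) (there (there j)) (All.lookup t∉ j)) (sym (one-mid i))) ∷
      label-pairs K len mid uq λ u w i j u∈ w∈ u≢w i≢j →
        trans (indep⇒adj clique (there (there u∈)) (there (there w∈)) u≢w) (sym (mid-mid i≢j))

  ≅⇒pattern : G ≅ H → Pattern
  ≅⇒pattern iso = record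
    { perm = ψ-labels ; clique = ψ-clique ; ab = ψ-h-false end₀-end₁
    ; as = ψ-h-false end₀-zero ; at = ψ-h-true (λ ()) end₀-one ; aK = ψ-mid-end zero
    ; bs = ψ-h-true (λ ()) end₁-zero ; bt = ψ-h-false end₁-one ; bK = ψ-mid-end (suc zero) ; len = mids-length }
    where open FromIso iso

  rest-length : ∀ {a b K} → allFin n ↭ a ∷ b ∷ K → length K ≡ suc (suc m)
  rest-length p = suc-injective (suc-injective
    (trans (sym (↭-length p)) (trans (length-tabulate (λ i → i)) (trans n≡ (+-comm k 2)))))

  common-all : ∀ a b K → (∀ {u} → u ∈ K → h a u ≡ true) → common a b K ≡ deg b K
  common-all a b []      f = refl
  common-all a b (u ∷ K) f = cong₂ _+_
    (trans (cong (λ e → ⟦ e ⟧ * ⟦ h b u ⟧) (f (here refl))) (+-identityʳ _)) (common-all a b K (f ∘ there))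

  -- `a` misses a single entry `s`, so on the rest the common neighbours are the neighbours of `b`,
  -- and there are `m` of them. As `b` has degree `m + 1`, it is related to `s` and therefore misses
  -- some other entry `t`.
  extremal⇒pattern : Extremal₂ m (allFin n) → Pattern
  extremal⇒pattern (a , b , K , p , ¬1 , ab , da , db , cm)
    with s , K₁ , p₁ , as ← non-neighbour a K (subst₂ _<_ (sym da) (sym (rest-length p)) ≤-refl) = second
    where
    l₁ : length K₁ ≡ suc m
    l₁ = suc-injective (trans (sym (↭-length p₁)) (rest-length p))
    aK₁ : ∀ {u} → u ∈ K₁ → h a u ≡ true
    aK₁ = deg-full a K₁ (≤-reflexive (trans l₁ (trans (sym da) (trans (deg-↭ a p₁) (cong (λ e → ⟦ e ⟧ + deg a K₁) as)))))
    db₁ : deg b K₁ ≡ m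
    db₁ = trans (sym (common-all a b K₁ aK₁)) (trans (cong (λ e → ⟦ e ⟧ * ⟦ h b s ⟧ + common a b K₁) (sym as))
      (trans (sym (sumP-↭ (length K) (λ _ _ _ → refl) ≤-refl p₁)) cm))
    one : ∀ {e} → ⟦ e ⟧ ≡ 1 → e ≡ true
    one {true} _ = refl
    bs : h b s ≡ true
    bs = one (+-cancelʳ-≡ m _ 1 (trans (cong (⟦ h b s ⟧ +_) (sym db₁)) (trans (sym (deg-↭ b p₁)) db)))
    second : Pattern
    second with t , K₂ , p₂ , bt ← non-neighbour b K₁ (subst₂ _<_ (sym db₁) (sym l₁) ≤-refl) = record
      { perm = ↭-trans p (prep a (prep b (↭-trans p₁ (prep s p₂))))
      ; clique = λ e → ¬1 (Mat-↭ (↭-sym (↭-trans p₁ (prep s p₂))) e)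
      ; ab = ab ; as = as ; at = aK₁ (∈-resp-↭ (↭-sym p₂) (here refl))
      ; aK = λ i → aK₁ (∈-resp-↭ (↭-sym p₂) (there i)) ; bs = bs ; bt = bt
      ; bK = deg-full b K₂ (≤-reflexive (trans l₂ (trans (sym db₁) (trans (deg-↭ b p₂) (cong (λ e → ⟦ e ⟧ + deg b K₂) bt)))))
      ; len = l₂ }
      where
      l₂ : length K₂ ≡ m
      l₂ = suc-injective (trans (sym (↭-length p₂)) l₁)

  pattern⇒N : Pattern → ∀ z →
    N (allFin n) (suc (suc (z + m))) ≡ fall (suc (suc (z + m))) (suc (suc m)) * suc ((z + m) * suc (z + m))
  pattern⇒N pat z = begin
    N (allFin n) x
      ≡⟨ N-↭ h-sym x perm ⟩
    N (a ∷ b ∷ K′) x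
      ≡⟨ N-double-star a b K′ x (suc m) clique (rest-length perm) ⟩
    φ * doubleStar (z + m ∸ m) (deg a K′) (deg b K′) ⟦ h a b ⟧ (cross a b K′)
      ≡⟨ cong₂ (λ i e → φ * doubleStar i (deg a K′) (deg b K′) ⟦ e ⟧ (cross a b K′)) (m+n∸n≡m z m) ab ⟩
    φ * doubleStar z (deg a K′) (deg b K′) 0 (cross a b K′)
      -- Adding the number `z + m` of clashes makes `doubleStar-complete` applicable without
      -- subtraction: the value is `(z + m + 1)² − (z + m)`.
      ≡⟨ cong (φ *_) (+-cancelʳ-≡ (z + m) _ _ (begin
           doubleStar z (deg a K′) (deg b K′) 0 (cross a b K′) + (z + m)
             ≡⟨ doubleStar-complete z 0 (trans (cong (cross a b K′ +_) (sym com)) (cross+common a b K′)) ⟩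
           (z + deg a K′) * (z + deg b K′) + 0
             ≡⟨ cong₂ (λ p q → (z + p) * (z + q) + 0) da db ⟩
           (z + suc m) * (z + suc m) + 0
             ≡⟨ square z m ⟩
           suc ((z + m) * suc (z + m)) + (z + m) ∎)) ⟩
    φ * suc ((z + m) * suc (z + m)) ∎
    where
    open ≡-Reasoning
    open Pattern pat
    x = suc (suc (z + m))
    φ = fall x (suc (suc m))
    K′ = s ∷ t ∷ K
    da : deg a K′ ≡ suc m
    da = trans (cong₂ (λ e f → ⟦ e ⟧ + (⟦ f ⟧ + deg a K)) as at) (cong suc (trans (deg-all a K aK) len))
    db : deg b K′ ≡ suc m
    db = trans (cong₂ (λ e f → ⟦ e ⟧ + (⟦ f ⟧ + deg b K)) bs bt) (cong suc (trans (deg-all b K bK) len))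
    com : common a b K′ ≡ m
    com = trans (cong₂ (λ e f → ⟦ e ⟧ * ⟦ h b s ⟧ + (⟦ h a t ⟧ * ⟦ f ⟧ + common a b K)) as bt)
      (trans (cong (_+ common a b K) (*-zeroʳ ⟦ h a t ⟧)) (trans (common-all a b K aK) (trans (deg-all b K bK) len)))
    square : ∀ z m → (z + suc m) * (z + suc m) + 0 ≡ suc ((z + m) * suc (z + m)) + (z + m)
    square = solve-∀

-- Comparison with the claimed bound over the integers.

-- Imported only here because the prefix +_ of ℤ makes sections of _+_ ambiguous.
open import Data.Integer.Base as ℤ using (ℤ; +_; -1ℤ) renaming (_≤_ to _≤ℤ_)

-- A strict inequality refutes both sides of the equivalence, while an attained bound with its
-- witness establishes both.
extremal⇒bound : ∀ {p q B bd} {E I : Set} → p ≡ q → bd ≡ + B → q < B ⊎ (q ≡ B × E) → (E → I) → (I → q ≡ B) →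
  (+ p ≤ℤ bd) × ((+ p ≡ bd) ⇔ I)
extremal⇒bound refl refl (inj₁ lt)       f g = ℤ.+≤+ (<⇒≤ lt) ,
  mk⇔ (λ e → ⊥-elim (<⇒≢ lt (ℤ.+-injective e))) (λ i → cong +_ (g i))
extremal⇒bound refl refl (inj₂ (eq , e)) f g = ℤ.+≤+ (≤-reflexive eq) , mk⇔ (λ _ → f e) (λ i → cong +_ (g i))

-- The sign is not tracked: in either case the bracket is a natural number `Q` that is at least the
-- power minus one.
signed-power : ∀ φ w d → ∃ λ Q → + φ ℤ.* (+ (suc w ^ (d + 1)) ℤ.+ -1ℤ ℤ.^ d) ≡ + (φ * Q) × suc w ^ (d + 1) ≤ suc Q
signed-power φ w d with sign d
  where
  sign : ∀ d → -1ℤ ℤ.^ d ≡ + 1 ⊎ -1ℤ ℤ.^ d ≡ -1ℤ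
  sign zero    = inj₁ refl
  sign (suc d) with sign d
  ... | inj₁ e = inj₂ (cong (-1ℤ ℤ.*_) e)
  ... | inj₂ e = inj₁ (cong (-1ℤ ℤ.*_) e)
... | inj₁ e = suc w ^ (d + 1) + 1 , trans (cong (λ i → + φ ℤ.* (+ (suc w ^ (d + 1)) ℤ.+ i)) e) (sym (ℤ.pos-* φ _)) ,
  ≤-trans (m≤m+n _ 1) (n≤1+n _)
... | inj₂ e with suc w ^ (d + 1) | m^n>0 (suc w) (d + 1)
...   | suc q | _ = q , trans (cong (λ i → + φ ℤ.* (+ suc q ℤ.+ i)) e) (sym (ℤ.pos-* φ q)) , ≤-refl

-- The `2` in the hypothesis pays one for a possible `−1` in the bound and one for strictness. The
-- extra factor `suc (suc w)`, that is `x`, is what `fall x k` contains beyond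
-- `fall (x − 1) (k − 1)`.
bound-strict : ∀ m d w {p F} → m ≤ w → p ≤ fall (suc (suc w)) (suc (suc m)) * F → suc (suc w) * F + 2 ≤ suc w ^ (d + 1) →
  ∃ λ B → bound (suc (suc m)) (suc (suc m) + d) (suc (suc w)) ≡ + B × p < B
bound-strict m d w {p} {F} m≤w p≤ gap with Q , eq , le ← signed-power (fall (suc w) (suc m)) w d =
  φ * Q , trans (cong (λ i → + φ ℤ.* (+ (suc w ^ (i + 1)) ℤ.+ -1ℤ ℤ.^ i)) (m+n∸m≡n m d)) eq , (begin-strict
    p                            ≤⟨ p≤ ⟩
    suc (suc w) * φ * F          ≡⟨ rotate (suc (suc w)) φ F ⟩
    φ * (suc (suc w) * F)        <⟨ *-monoʳ-< φ {{>-nonZero (fall-pos (s≤s m≤w))}}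
                                     (≤-pred (≤-trans (≤-reflexive (+-comm 2 _)) (≤-trans gap le))) ⟩
    φ * Q                        ∎)
  where
  open ≤-Reasoning
  φ = fall (suc w) (suc m)
  rotate : ∀ x f F → x * f * F ≡ f * (x * F)
  rotate = solve-∀

fall≤^ : ∀ a e y → a ≤ y → fall a e ≤ y ^ e
fall≤^ a zero    y l = ≤-refl
fall≤^ a (suc e) y l = *-mono-≤ l (fall≤^ (a ∸ 1) e y (≤-trans (m∸n≤m a 1) l))

-- With `x = v + 4`, the difference `(x − 1)⁴ − x (x − 1)² (x − 2)` is `(x − 1)² = v² + 6v + 9`.
gap-3 : ∀ v → let w = suc (suc v) in suc (suc w) * (fall (suc w) 2 * suc w) + 2 ≤ suc w ^ 4
gap-3 v = ≤-trans (m≤m+n ((4 + v) * ((3 + v) * ((2 + v) * 1) * (3 + v)) + 2) (v * v + 6 * v + 7)) (≤-reflexive (expand v))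
  where
  expand : ∀ v → (4 + v) * ((3 + v) * ((2 + v) * 1) * (3 + v)) + 2 + (v * v + 6 * v + 7)
               ≡ (3 + v) * ((3 + v) * ((3 + v) * ((3 + v) * 1)))
  expand = solve-∀

-- With `x = v + 4`, the falling factors after the fourth are replaced by `x − 1`. What remains is
-- `(x − 1)⁴ − x² (x − 2)(x − 3) = x³ − 4x + 1 = v³ + 12v² + 44v + 49`.
gap-4 : ∀ v e → let w = suc (suc v) in suc (suc w) * fall (suc (suc w)) (4 + e) + 2 ≤ suc w ^ (4 + e + 1)
gap-4 v e = begin
  (4 + v) * ((4 + v) * ((3 + v) * ((2 + v) * ((1 + v) * f)))) + 2
    ≡⟨ collect v f ⟩
  (3 + v) * (A * f) + 2
    ≤⟨ +-mono-≤ (*-monoʳ-≤ (3 + v) (*-monoʳ-≤ A (fall≤^ v e (3 + v) (m≤n+m v 3))))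
         (*-monoʳ-≤ 2 (m^n>0 (3 + v) (1 + e))) ⟩
  (3 + v) * (A * y) + 2 * ((3 + v) * y)
    ≡⟨ factor (3 + v) A y ⟩
  (A + 2) * ((3 + v) * y)
    ≤⟨ *-monoˡ-≤ ((3 + v) * y) (m≤m+n (A + 2) (v * v * v + 12 * (v * v) + 44 * v + 47)) ⟩
  (A + 2 + (v * v * v + 12 * (v * v) + 44 * v + 47)) * ((3 + v) * y)
    ≡⟨ expand v y ⟩
  (3 + v) * ((3 + v) * ((3 + v) * ((3 + v) * ((3 + v) * y))))
    ≡⟨ cong (λ i → (3 + v) ^ (4 + i)) (+-comm 1 e) ⟩
  (3 + v) ^ (4 + e + 1) ∎
  where
  open ≤-Reasoning
  f = fall v e
  y = (3 + v) ^ e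
  A = (4 + v) * (4 + v) * ((2 + v) * (1 + v))
  collect : ∀ v f → (4 + v) * ((4 + v) * ((3 + v) * ((2 + v) * ((1 + v) * f)))) + 2
                  ≡ (3 + v) * ((4 + v) * (4 + v) * ((2 + v) * (1 + v)) * f) + 2
  collect = solve-∀
  factor : ∀ u a y → u * (a * y) + 2 * (u * y) ≡ (a + 2) * (u * y)
  factor = solve-∀
  expand : ∀ v y → ((4 + v) * (4 + v) * ((2 + v) * (1 + v)) + 2 + (v * v * v + 12 * (v * v) + 44 * v + 47)) * ((3 + v) * y)
                 ≡ (3 + v) * ((3 + v) * ((3 + v) * ((3 + v) * ((3 + v) * y))))
  expand = solve-∀

-- `(x − 1)² − 1 = x (x − 2)`, and the factor `x` completes the falling factorial to `(x)ₖ`.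
bound-1 : ∀ m w → bound (suc (suc m)) (suc (suc m) + 1) (suc (suc w)) ≡ + (fall (suc (suc w)) (suc (suc m)) * w)
bound-1 m w = trans (cong (λ i → + φ ℤ.* (+ (suc w ^ (i + 1)) ℤ.+ -1ℤ ℤ.^ i)) (m+n∸m≡n m 1))
  (trans (sym (ℤ.pos-* φ _)) (cong +_ (square φ w)))
  where
  φ = fall (suc w) (suc m)
  square : ∀ f w → f * (w * 1 + w * suc (w * 1)) ≡ suc (suc w) * f * w
  square = solve-∀

-- `(x − 1)³ + 1 = x ((x − 2)(x − 1) + 1)`, the factor `x` being absorbed as before.
bound-2 : ∀ m w → bound (suc (suc m)) (suc (suc m) + 2) (suc (suc w)) ≡ + (fall (suc (suc w)) (suc (suc m)) * suc (w * suc w))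
bound-2 m w = trans (cong (λ i → + φ ℤ.* (+ (suc w ^ (i + 1)) ℤ.+ -1ℤ ℤ.^ i)) (m+n∸m≡n m 2))
  (trans (sym (ℤ.pos-* φ _)) (cong +_ (cube φ w)))
  where
  φ = fall (suc w) (suc m)
  cube : ∀ f w → f * (suc w * (suc w * (suc w * 1)) + 1) ≡ suc (suc w) * f * suc (w * suc w)
  cube = solve-∀

-- The cases of the excess `d = n − k`, with `m = k − 2`, `z = x − k` and `w = x − 2`.

module Excess-cases (m z : ℕ) (2≤m : 2 ≤ m) where

  k x w : ℕ
  k = suc (suc m)
  w = z + m
  x = suc (suc w)

  m≤w : m ≤ w
  m≤w = m≤n+m m z

  Claim : ∀ d → Graph (k + d) → Set
  Claim d G = (+ P G x ≤ℤ bound k (k + d) x) ×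
    ((+ P G x ≡ bound k (k + d) x) ⇔ (G ≅ G[ k + 1 , k ] ⊎ G ≅ G[ k + 2 , k ]))

  module _ {d} (G : Graph (k + d)) (¬i₃ : ¬ IndepSet G 3)
    (¬col : ¬ Σ (Fin (k + d) → Fin (suc m)) (IsProper G)) where

    open Chromatic G ¬i₃

    ¬Mat : ¬ Mat (suc d) (allFin (k + d))
    ¬Mat e = ¬col (Mat⇒colouring (suc m) (cong suc (sym (+-suc m d))) e)

    vertices : length (allFin (k + d)) ≡ k + d
    vertices = length-tabulate (λ i → i)

    absurd-size : ∀ {e} → d ≢ e → ¬ (G ≅ G[ k + e , k ])
    absurd-size {e} ne iso = ne (+-cancelˡ-≡ k d e (≅⇒≡ G G[ k + e , k ] iso))

    strict : d ≢ 1 → d ≢ 2 → ∀ F → N (allFin (k + d)) x ≤ fall x k * F → x * F + 2 ≤ suc w ^ (d + 1) → Claim d G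
    strict d≢1 d≢2 F p≤ gap = conclude (bound-strict m d w m≤w (≤-trans (≤-reflexive (P≡N G ¬i₃ x)) p≤) gap)
      where
      conclude : (∃ λ B → bound k (k + d) x ≡ + B × P G x < B) → Claim d G
      conclude (B , eq , lt) = extremal⇒bound refl eq (inj₁ lt) ⊥-elim λ
        { (inj₁ iso) → ⊥-elim (absurd-size d≢1 iso) ; (inj₂ iso) → ⊥-elim (absurd-size d≢2 iso) }

  excess₁ : ∀ (G : Graph (k + 1)) → TwoConnected G → (¬i₃ : ¬ IndepSet G 3) →
    ¬ Σ (Fin (k + 1) → Fin (suc m)) (IsProper G) → Claim 1 G
  excess₁ G tc ¬i₃ ¬col = extremal⇒bound (P≡N G ¬i₃ x) (bound-1 m w)
    (N-bound-1 (allFin (k + 1)) m z (vertices G ¬i₃ ¬col) (¬Mat G ¬i₃ ¬col)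
      -- 2-connectedness enters here: the degrees in the complement are at most `n − 3 = m`.
      (λ v _ → +-cancelʳ-≤ 3 _ _ (≤-trans (degree-bound G ¬i₃ tc v) (≤-reflexive (shift₃ m)))))
    (inj₁ ∘ pattern⇒≅ ∘ extremal⇒pattern)
    λ { (inj₁ iso) → pattern⇒N (≅⇒pattern iso) z
      ; (inj₂ iso) → ⊥-elim (absurd-size G ¬i₃ ¬col (λ ()) iso) }
    where
    open Chromatic G ¬i₃
    open Isomorphism₁ G ¬i₃ m refl
    shift₃ : ∀ m → suc (suc m) + 1 ≡ m + 3
    shift₃ = solve-∀

  excess₂ : ∀ (G : Graph (k + 2)) → TwoConnected G → (¬i₃ : ¬ IndepSet G 3) →
    ¬ Σ (Fin (k + 2) → Fin (suc m)) (IsProper G) → Claim 2 G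
  excess₂ G tc ¬i₃ ¬col = extremal⇒bound (P≡N G ¬i₃ x) (bound-2 m w)
    (N-bound-2 (allFin (k + 2)) m z 2≤m (vertices G ¬i₃ ¬col) (¬Mat G ¬i₃ ¬col)
      (λ v _ → +-cancelʳ-≤ 3 _ _ (≤-trans (degree-bound G ¬i₃ tc v) (≤-reflexive (shift₃ m)))))
    (inj₂ ∘ pattern⇒≅ ∘ extremal⇒pattern)
    λ { (inj₂ iso) → pattern⇒N (≅⇒pattern iso) z
      ; (inj₁ iso) → ⊥-elim (absurd-size G ¬i₃ ¬col (λ ()) iso) }
    where
    open Chromatic G ¬i₃
    open Isomorphism₂ G ¬i₃ m refl
    shift₃ : ∀ m → suc (suc m) + 2 ≡ suc m + 3
    shift₃ = solve-∀

  private
    -- The gap estimates are written in `v = x − 4`, available because `x ≥ k ≥ 4`.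
    w≡ : w ≡ suc (suc (w ∸ 2))
    w≡ = sym (trans (+-comm 2 (w ∸ 2)) (m∸n+n≡m (≤-trans 2≤m m≤w)))

  excess₃ : ∀ (G : Graph (k + 3)) → TwoConnected G → (¬i₃ : ¬ IndepSet G 3) →
    ¬ Σ (Fin (k + 3) → Fin (suc m)) (IsProper G) → Claim 3 G
  excess₃ G tc@(_ , conn , _) ¬i₃ ¬col = strict G ¬i₃ ¬col (λ ()) (λ ()) (fall (suc w) 2 * suc w)
    (N-bound-3 (suc m) (allFin (k + 3)) x (s≤s 2≤m) (s≤s (s≤s m≤w)) (vertices G ¬i₃ ¬col)
      (¬Mat G ¬i₃ ¬col) (connected⇒¬join G ¬i₃ conn))
    (subst (λ w → suc (suc w) * (fall (suc w) 2 * suc w) + 2 ≤ suc w ^ 4) (sym w≡) (gap-3 (w ∸ 2)))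
    where
    open Chromatic G ¬i₃

  excess≥4 : ∀ e (G : Graph (k + (4 + e))) → TwoConnected G → Σ (Fin (k + (4 + e)) → Fin k) (IsProper G) →
    (¬i₃ : ¬ IndepSet G 3) → ¬ Σ (Fin (k + (4 + e)) → Fin (suc m)) (IsProper G) → Claim (4 + e) G
  excess≥4 e G tc col ¬i₃ ¬col = strict G ¬i₃ ¬col (λ ()) (λ ()) (fall x (4 + e))
    (N-bound _ k (4 + e) (allFin (k + (4 + e))) x (vertices G ¬i₃ ¬col) ≤-refl
      -- `N-bound` requires `d ≤ k`, which is `n ≤ 2k`.
      (+-cancelˡ-≤ k (4 + e) k (colouring⇒n≤2k col)) (¬Mat G ¬i₃ ¬col))
    (subst (λ w → suc (suc w) * fall (suc (suc w)) (4 + e) + 2 ≤ suc w ^ (4 + e + 1)) (sym w≡) (gap-4 (w ∸ 2) e))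
    where open Chromatic G ¬i₃

  every-excess : ∀ d → d ≢ 0 → (G : Graph (k + d)) → TwoConnected G → ChromaticNumber G k → IndependenceNumber G 2 → Claim d G
  every-excess 0                         d≢0 G tc _             _         = ⊥-elim (d≢0 refl)
  every-excess 1                         d≢0 G tc (_ , ¬col)    (_ , ¬i₃) = excess₁ G tc ¬i₃ ¬col
  every-excess 2                         d≢0 G tc (_ , ¬col)    (_ , ¬i₃) = excess₂ G tc ¬i₃ ¬col
  every-excess 3                         d≢0 G tc (_ , ¬col)    (_ , ¬i₃) = excess₃ G tc ¬i₃ ¬col
  every-excess (suc (suc (suc (suc e)))) d≢0 G tc (col , ¬col)  (_ , ¬i₃) = excess≥4 e G tc col ¬i₃ ¬col

theorem3p12 : ∀ (k n : ℕ) → 4 ≤ k → k < n → (G : Graph n) →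
    TwoConnected G → ChromaticNumber G k → IndependenceNumber G 2 →
    ∀ (x : ℕ) → k ≤ x →
    (+ P G x ≤ℤ bound k n x) ×
    ((+ P G x ≡ bound k n x) ⇔ (G ≅ G[ k + 1 , k ] ⊎ G ≅ G[ k + 2 , k ]))
theorem3p12 k n 4≤k k<n G tc χ α x k≤x with m≤n⇒∃[o]m+o≡n (<⇒≤ k<n) | m≤n⇒∃[o]m+o≡n k≤x
theorem3p12 (suc (suc m)) _ (s≤s (s≤s 2≤m)) k<n G tc χ α _ k≤x | d , refl | z , refl =
  -- The decomposition of `x` yields `m + z`, whereas the counts are stated with `z + m`.
  subst (λ s → (+ P G (suc (suc s)) ≤ℤ bound k (k + d) (suc (suc s))) ×
               ((+ P G (suc (suc s)) ≡ bound k (k + d) (suc (suc s))) ⇔ (G ≅ G[ k + 1 , k ] ⊎ G ≅ G[ k + 2 , k ])))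
    (+-comm z m) (Excess-cases.every-excess m z 2≤m d
      (λ { refl → <-irrefl (sym (+-identityʳ k)) k<n }) G tc χ α)
  where k = suc (suc m)
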